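{- Let $m$ be a complex number, $x$ an indeterminate, and let $\mathcal{F}_m(n,x)=\sum_{k=0}^n k!\,W_m(n,k)x^k$ be the Tanny-Dowling polynomials. Then, as formal power series in $z$, $$\sum_{n=0}^{\infty}\mathcal{F}_m(n,x)z^n=\cfrac{1}{1-b_0z-\cfrac{\lambda_1z^2}{1-b_1z-\cfrac{\lambda_2z^2}{1-b_2z-\cfrac{\lambda_3z^2}{1-b_3z-\cdots}}}},$$ where $b_n=(2n+1)x+nm+1$ for $n\ge 0$ and $\lambda_n=n^2x(x+m)$ for $n\ge 1$. Consequently, the Hankel transform $h_n=\det\big(\mathcal{F}_m(i+j,x)\big)_{0\le i,j\le n}$ of the sequence $(\mathcal{F}_m(n,x))_{n\ge 0}$ is, for all $n\ge 0$, $$h_n=(x(x+m))^{\binom{n+1}{2}}\prod_{k=0}^n k!^2.$$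
   Context: The Whitney numbers of the second kind of Dowling lattices are $W_m(n,k)=\sum_{i=k}^n\binom{n}{i}m^{i-k}S(i,k)$ (with $0^0=1$), where $S(i,k)$ are the Stirling numbers of the second kind; for $m\ne 0$ this is equivalent to $\sum_{n\ge 0} W_m(n,k)\frac{z^n}{n!}=\frac{e^z}{m^k k!}(e^{mz}-1)^k$, and $W_0(n,k)=\binom{n}{k}$. The infinite continued fraction denotes the limit, in the $z$-adic topology on $\mathbb{C}[x][[z]]$, of its finite truncations. The Hankel transform of a sequence $(a_n)_{n\ge 0}$ is the sequence of determinants $h_n=\det(a_{i+j})_{0\le i,j\le n}$. -}

module Defs where

open import Algebra.Bundles using (CommutativeRing; RawRing)
open import Algebra.Structures using (IsCommutativeRing)
open import Algebra.Morphism.Structures using (IsRingMonomorphism)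
import Algebra.Morphism.RingMonomorphism as RingMonomorphism
import Algebra.Properties.Ring as RingProperties
import Algebra.Properties.Semiring.Exp as Exp
import Algebra.Properties.Semiring.Mult as Mult
import Algebra.Properties.Semiring.Sum as Sum
open import Data.Fin.Base using (Fin; zero; suc; toℕ; punchIn)
open import Data.Fin.Properties using (toℕ≤pred[n])
open import Data.Nat.Base as ℕ using (ℕ; zero; suc; _!; _∸_; _≤_; _<_; z≤n; s≤s)
open import Data.Nat.Combinatorics using (_C_)
import Data.Nat.Properties as ℕₚ
open import Data.Product.Base using (∃; _,_; proj₁; proj₂)
open import Level using (Level; _⊔_)
open import Relation.Binary.PropositionalEquality.Core as ≡ using (_≡_)
open import Relation.Nullary.Decidable.Core using (yes; no)

stirling₂ : ℕ → ℕ → ℕ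
stirling₂ zero    zero    = 1
stirling₂ zero    (suc k) = 0
stirling₂ (suc n) zero    = 0
stirling₂ (suc n) (suc k) = suc k ℕ.* stirling₂ n (suc k) ℕ.+ stirling₂ n k

module PowerSeries {a ℓ : Level} (A : CommutativeRing a ℓ) where

  open CommutativeRing A hiding (zero)
  open RingProperties ring using (-0#≈0#)
  open Sum semiring
  open import Relation.Binary.Reasoning.Setoid setoid

  Series : Set a
  Series = ℕ → Carrier

  infix 4 _≋_

  record _≋_ (f g : Series) : Set ℓ where
    constructor coeffwise
    field coeff≈ : ∀ n → f n ≈ g n

  open _≋_ public

  infixl 7 _⊛_

  _⊛_ : Series → Series → Series
  (f ⊛ g) n = ∑[ i ≤ n ] (f (toℕ i) * g (n ∸ toℕ i))

  constₛ : Carrier → Series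
  constₛ c zero    = c
  constₛ c (suc n) = 0#

  z : Series
  z zero          = 0#
  z (suc zero)    = 1#
  z (suc (suc n)) = 0#

  rawRing-series : RawRing a ℓ
  rawRing-series = record
    { Carrier = Series
    ; _≈_     = _≋_
    ; _+_     = λ f g n → f n + g n
    ; _*_     = _⊛_
    ; -_      = λ f n → - f n
    ; 0#      = λ _ → 0#
    ; 1#      = constₛ 1#
    }

  private

    tl : Series → Series
    tl f n = f (suc n)

    ∑≤-cong : ∀ n (t t′ : Fin (suc n) → Carrier) → (∀ i → t i ≈ t′ i) →
              ∑[ i ≤ n ] t i ≈ ∑[ i ≤ n ] t′ i
    ∑≤-cong n t t′ p = sum-cong-≋ {suc n} {t} {t′} p

    -- Congruence that only looks at the coefficients that occur.
    ⊛-cong≤ : ∀ f f′ g g′ n → (∀ i → i ≤ n → f i ≈ f′ i) → (∀ i → i ≤ n → g i ≈ g′ i) →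
              (f ⊛ g) n ≈ (f′ ⊛ g′) n
    ⊛-cong≤ f f′ g g′ n p q = ∑≤-cong n (λ i → f (toℕ i) * g (n ∸ toℕ i)) (λ i → f′ (toℕ i) * g′ (n ∸ toℕ i)) λ i →
      *-cong (p (toℕ i) (toℕ≤pred[n] i)) (q (n ∸ toℕ i) (ℕₚ.m∸n≤m n (toℕ i)))

    ⊛-zero : ∀ f g n → (∀ i → i ≤ n → g i ≈ 0#) → (f ⊛ g) n ≈ 0#
    ⊛-zero f g n q = begin
      (f ⊛ g) n               ≈⟨ ∑≤-cong n (λ i → f (toℕ i) * g (n ∸ toℕ i)) (λ _ → 0#)
                                    (λ i → trans (*-congˡ (q (n ∸ toℕ i) (ℕₚ.m∸n≤m n (toℕ i)))) (zeroʳ _)) ⟩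
      ∑[ i ≤ n ] 0#           ≈⟨ sum-replicate-zero (suc n) ⟩
      0#                      ∎

    ⊛-cong : ∀ {f f′ g g′} → f ≋ f′ → g ≋ g′ → f ⊛ g ≋ f′ ⊛ g′
    ⊛-cong {f} {f′} {g} {g′} p q = coeffwise λ n →
      ⊛-cong≤ f f′ g g′ n (λ i _ → coeff≈ p i) (λ i _ → coeff≈ q i)

    ⊛-last : ∀ f g n → (f ⊛ g) (suc n) ≈ (f ⊛ tl g) n + f (suc n) * g 0
    ⊛-last f g zero = begin
      f 0 * g 1 + (f 1 * g 0 + 0#)  ≈⟨ +-congˡ (+-identityʳ _) ⟩
      f 0 * g 1 + f 1 * g 0         ≈⟨ +-congʳ (+-identityʳ _) ⟨
      (f 0 * g 1 + 0#) + f 1 * g 0  ∎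
    ⊛-last f g (suc n) = begin
      f 0 * g (suc (suc n)) + (tl f ⊛ g) (suc n)
        ≈⟨ +-congˡ (⊛-last (tl f) g n) ⟩
      f 0 * g (suc (suc n)) + ((tl f ⊛ tl g) n + f (suc (suc n)) * g 0)
        ≈⟨ +-assoc _ _ _ ⟨
      (f ⊛ tl g) (suc n) + f (suc (suc n)) * g 0 ∎

    ⊛-comm-at : ∀ f g n → (f ⊛ g) n ≈ (g ⊛ f) n
    ⊛-comm-at f g zero    = +-congʳ (*-comm _ _)
    ⊛-comm-at f g (suc n) = begin
      f 0 * g (suc n) + (tl f ⊛ g) n  ≈⟨ +-cong (*-comm _ _) (⊛-comm-at (tl f) g n) ⟩
      g (suc n) * f 0 + (g ⊛ tl f) n  ≈⟨ +-comm _ _ ⟩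
      (g ⊛ tl f) n + g (suc n) * f 0  ≈⟨ ⊛-last g f n ⟨
      (g ⊛ f) (suc n)                 ∎

    ⊛-comm : ∀ f g → f ⊛ g ≋ g ⊛ f
    ⊛-comm f g = coeffwise (⊛-comm-at f g)

    ⊛-distribʳ-at : ∀ h f g n → ((λ k → f k + g k) ⊛ h) n ≈ (f ⊛ h) n + (g ⊛ h) n
    ⊛-distribʳ-at h f g n = trans
      (∑≤-cong n (λ i → (f (toℕ i) + g (toℕ i)) * h (n ∸ toℕ i))
                 (λ i → f (toℕ i) * h (n ∸ toℕ i) + g (toℕ i) * h (n ∸ toℕ i))
                 (λ i → distribʳ _ _ _))
      (∑-distrib-+ {suc n} (λ i → f (toℕ i) * h (n ∸ toℕ i)) (λ i → g (toℕ i) * h (n ∸ toℕ i)))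

    ⊛-distribʳ : ∀ h f g → (λ k → f k + g k) ⊛ h ≋ (λ n → (f ⊛ h) n + (g ⊛ h) n)
    ⊛-distribʳ h f g = coeffwise (⊛-distribʳ-at h f g)

    ⊛-distribˡ : ∀ h f g → h ⊛ (λ k → f k + g k) ≋ (λ n → (h ⊛ f) n + (h ⊛ g) n)
    ⊛-distribˡ h f g = coeffwise λ n → begin
      (h ⊛ (λ k → f k + g k)) n  ≈⟨ ⊛-comm-at h (λ k → f k + g k) n ⟩
      ((λ k → f k + g k) ⊛ h) n  ≈⟨ ⊛-distribʳ-at h f g n ⟩
      (f ⊛ h) n + (g ⊛ h) n      ≈⟨ +-cong (⊛-comm-at f h n) (⊛-comm-at g h n) ⟩
      (h ⊛ f) n + (h ⊛ g) n      ∎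

    ⊛-scale : ∀ c f g n → ((λ k → c * f k) ⊛ g) n ≈ c * (f ⊛ g) n
    ⊛-scale c f g n = trans
      (∑≤-cong n (λ i → (c * f (toℕ i)) * g (n ∸ toℕ i))
                 (λ i → c * (f (toℕ i) * g (n ∸ toℕ i)))
                 (λ i → *-assoc _ _ _))
      (sym (*-distribˡ-sum {suc n} c (λ i → f (toℕ i) * g (n ∸ toℕ i))))

    ⊛-assoc-at : ∀ f g h n → ((f ⊛ g) ⊛ h) n ≈ (f ⊛ (g ⊛ h)) n
    ⊛-assoc-at f g h zero = +-congʳ (begin
      (f 0 * g 0 + 0#) * h 0  ≈⟨ *-congʳ (+-identityʳ _) ⟩
      f 0 * g 0 * h 0         ≈⟨ *-assoc _ _ _ ⟩
      f 0 * (g 0 * h 0)       ≈⟨ *-congˡ (+-identityʳ _) ⟨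
      f 0 * (g 0 * h 0 + 0#)  ∎)
    ⊛-assoc-at f g h (suc n) = begin
      (f 0 * g 0 + 0#) * h (suc n) + (tl (f ⊛ g) ⊛ h) n
        ≈⟨ +-cong (trans (*-congʳ (+-identityʳ _)) (*-assoc _ _ _))
                  (trans (⊛-distribʳ-at h (λ k → f 0 * g (suc k)) (tl f ⊛ g) n)
                         (+-cong (⊛-scale (f 0) (tl g) h n) (⊛-assoc-at (tl f) g h n))) ⟩
      f 0 * (g 0 * h (suc n)) + (f 0 * (tl g ⊛ h) n + (tl f ⊛ (g ⊛ h)) n)
        ≈⟨ +-assoc _ _ _ ⟨
      (f 0 * (g 0 * h (suc n)) + f 0 * (tl g ⊛ h) n) + (tl f ⊛ (g ⊛ h)) n
        ≈⟨ +-congʳ (distribˡ _ _ _) ⟨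
      f 0 * (g ⊛ h) (suc n) + (tl f ⊛ (g ⊛ h)) n ∎

    ⊛-assoc : ∀ f g h → (f ⊛ g) ⊛ h ≋ f ⊛ (g ⊛ h)
    ⊛-assoc f g h = coeffwise (⊛-assoc-at f g h)

    ⊛-identityˡ-at : ∀ f n → (constₛ 1# ⊛ f) n ≈ f n
    ⊛-identityˡ-at f zero    = trans (+-identityʳ _) (*-identityˡ _)
    ⊛-identityˡ-at f (suc n) = begin
      1# * f (suc n) + ((λ _ → 0#) ⊛ f) n
        ≈⟨ +-cong (*-identityˡ _) (trans (⊛-comm-at (λ _ → 0#) f n) (⊛-zero f (λ _ → 0#) n (λ _ _ → refl))) ⟩
      f (suc n) + 0#  ≈⟨ +-identityʳ _ ⟩
      f (suc n)       ∎

    ⊛-identityˡ : ∀ f → constₛ 1# ⊛ f ≋ f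
    ⊛-identityˡ f = coeffwise (⊛-identityˡ-at f)

    ⊛-identityʳ : ∀ f → f ⊛ constₛ 1# ≋ f
    ⊛-identityʳ f = coeffwise λ n → trans (⊛-comm-at f (constₛ 1#) n) (⊛-identityˡ-at f n)

  isCommutativeRing-series :
    IsCommutativeRing _≋_ (RawRing._+_ rawRing-series) _⊛_ (RawRing.-_ rawRing-series)
                      (RawRing.0# rawRing-series) (RawRing.1# rawRing-series)
  isCommutativeRing-series = record
    { isRing = record
      { +-isAbelianGroup = record
        { isGroup = record
          { isMonoid = record
            { isSemigroup = record
              { isMagma = record
                { isEquivalence = record
                  { refl  = coeffwise λ n → refl
                  ; sym   = λ p → coeffwise λ n → sym (coeff≈ p n)
                  ; trans = λ p q → coeffwise λ n → trans (coeff≈ p n) (coeff≈ q n)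
                  }
                ; ∙-cong = λ p q → coeffwise λ n → +-cong (coeff≈ p n) (coeff≈ q n)
                }
              ; assoc = λ f g h → coeffwise λ n → +-assoc (f n) (g n) (h n)
              }
            ; identity = (λ f → coeffwise λ n → +-identityˡ (f n))
                       , (λ f → coeffwise λ n → +-identityʳ (f n))
            }
          ; inverse = (λ f → coeffwise λ n → -‿inverseˡ (f n))
                    , (λ f → coeffwise λ n → -‿inverseʳ (f n))
          ; ⁻¹-cong = λ p → coeffwise λ n → -‿cong (coeff≈ p n)
          }
        ; comm = λ f g → coeffwise λ n → +-comm (f n) (g n)
        }
      ; *-cong     = ⊛-cong
      ; *-assoc    = ⊛-assoc
      ; *-identity = ⊛-identityˡ , ⊛-identityʳ
      ; distrib    = ⊛-distribˡ , ⊛-distribʳ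
      }
    ; *-comm = ⊛-comm
    }

  seriesRing : CommutativeRing a ℓ
  seriesRing = record { isCommutativeRing = isCommutativeRing-series }

  private
    module 𝕊 = CommutativeRing seriesRing
    module Σₛ = Sum 𝕊.semiring
    open Exp 𝕊.semiring using (_^_)

  -- The limit of a sequence of series in the z-adic topology.
  infix 4 _⟶_

  _⟶_ : (ℕ → Series) → Series → Set ℓ
  T ⟶ f = ∀ N → ∃ λ K → ∀ k → K ≤ k → ∀ n → n < N → T k n ≈ f n

  -- The reciprocal of a series f with constant coefficient 1, as the geometric
  -- series ∑ (1 - f)ᵏ; the terms with k > n do not affect the coefficient of zⁿ.
  -- For any other f the value is meaningless.
  infix 9 _⁻¹

  _⁻¹ : Series → Series
  (f ⁻¹) n = (Σₛ.sum {suc n} λ k → (𝕊.1# 𝕊.- f) ^ toℕ k) n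

  ⁻¹-inverseʳ : ∀ f → f 0 ≈ 1# → f ⊛ f ⁻¹ ≋ 𝕊.1#
  ⁻¹-inverseʳ f f0≈1 = 𝕊R.begin
    f ⊛ f ⁻¹                            𝕊R.≈⟨ ⊛-cong f≋1-u 𝕊.refl ⟩
    (𝕊.1# 𝕊.- u) ⊛ f ⁻¹                 𝕊R.≈⟨ 𝕊.distribʳ (f ⁻¹) 𝕊.1# (𝕊.- u) ⟩
    𝕊.1# ⊛ f ⁻¹ 𝕊.+ (𝕊.- u) ⊛ f ⁻¹      𝕊R.≈⟨ 𝕊.+-cong (⊛-identityˡ (f ⁻¹)) (𝕊.sym (𝕊P.-‿distribˡ-* u (f ⁻¹))) ⟩
    f ⁻¹ 𝕊.- u ⊛ f ⁻¹                   𝕊R.≈⟨ 𝕊.+-congʳ {𝕊.- (u ⊛ f ⁻¹)} fixpoint ⟩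
    (𝕊.1# 𝕊.+ u ⊛ f ⁻¹) 𝕊.- u ⊛ f ⁻¹    𝕊R.≈⟨ 𝕊.+-assoc 𝕊.1# (u ⊛ f ⁻¹) (𝕊.- (u ⊛ f ⁻¹)) ⟩
    𝕊.1# 𝕊.+ (u ⊛ f ⁻¹ 𝕊.- u ⊛ f ⁻¹)    𝕊R.≈⟨ 𝕊.+-congˡ {𝕊.1#} (𝕊.-‿inverseʳ (u ⊛ f ⁻¹)) ⟩
    𝕊.1# 𝕊.+ 𝕊.0#                       𝕊R.≈⟨ 𝕊.+-identityʳ 𝕊.1# ⟩
    𝕊.1#                                𝕊R.∎
    where
    module 𝕊R where open import Relation.Binary.Reasoning.Setoid 𝕊.setoid public
    module 𝕊P = RingProperties 𝕊.ring

    u : Series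
    u = 𝕊.1# 𝕊.- f

    u0≈0 : u 0 ≈ 0#
    u0≈0 = trans (+-congˡ (-‿cong f0≈1)) (-‿inverseʳ 1#)

    f≋1-u : f ≋ 𝕊.1# 𝕊.- u
    f≋1-u = 𝕊.sym (𝕊R.begin
      𝕊.1# 𝕊.- (𝕊.1# 𝕊.- f)               𝕊R.≈⟨ 𝕊.+-congˡ {𝕊.1#} (𝕊.sym (𝕊P.-‿+-comm 𝕊.1# (𝕊.- f))) ⟩
      𝕊.1# 𝕊.+ ((𝕊.- 𝕊.1#) 𝕊.- (𝕊.- f))   𝕊R.≈⟨ 𝕊.sym (𝕊.+-assoc 𝕊.1# (𝕊.- 𝕊.1#) (𝕊.- (𝕊.- f))) ⟩
      (𝕊.1# 𝕊.- 𝕊.1#) 𝕊.- (𝕊.- f)         𝕊R.≈⟨ 𝕊.+-cong (𝕊.-‿inverseʳ 𝕊.1#) (𝕊P.-‿involutive f) ⟩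
      𝕊.0# 𝕊.+ f                          𝕊R.≈⟨ 𝕊.+-identityˡ f ⟩
      f                                   𝕊R.∎)

    G : ℕ → Series
    G n = Σₛ.sum {suc n} λ k → u ^ toℕ k

    horner : ∀ n → G (suc n) ≋ 𝕊.1# 𝕊.+ u ⊛ G n
    horner n = 𝕊.+-congˡ {𝕊.1#} (𝕊.sym (Σₛ.*-distribˡ-sum {suc n} u (λ k → u ^ toℕ k)))

    -- As u has no constant term, (u ⊛ g) (suc j) only sees g up to index j.
    u⊛-cong : ∀ g h j → (∀ i → i ≤ j → g i ≈ h i) → (u ⊛ g) (suc j) ≈ (u ⊛ h) (suc j)
    u⊛-cong g h j p = +-cong
      (trans (*-congʳ u0≈0) (trans (zeroˡ _) (sym (trans (*-congʳ u0≈0) (zeroˡ _)))))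
      (⊛-cong≤ (tl u) (tl u) g h j (λ _ _ → refl) p)

    u⊛-at0 : ∀ g → (u ⊛ g) 0 ≈ 0#
    u⊛-at0 g = trans (+-identityʳ _) (trans (*-congʳ u0≈0) (zeroˡ _))

    stable : ∀ n j → j ≤ n → G (suc n) j ≈ G n j
    stable zero    zero    z≤n     = begin
      G 1 0                  ≈⟨ coeff≈ (horner 0) 0 ⟩
      1# + (u ⊛ G 0) 0       ≈⟨ +-congˡ (u⊛-at0 (G 0)) ⟩
      1# + 0#                ∎
    stable (suc n) zero    z≤n     = begin
      G (suc (suc n)) 0         ≈⟨ coeff≈ (horner (suc n)) 0 ⟩
      1# + (u ⊛ G (suc n)) 0    ≈⟨ +-congˡ (trans (u⊛-at0 (G (suc n))) (sym (u⊛-at0 (G n)))) ⟩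
      1# + (u ⊛ G n) 0          ≈⟨ coeff≈ (horner n) 0 ⟨
      G (suc n) 0               ∎
    stable (suc n) (suc j) (s≤s j≤n) = begin
      G (suc (suc n)) (suc j)         ≈⟨ coeff≈ (horner (suc n)) (suc j) ⟩
      0# + (u ⊛ G (suc n)) (suc j)    ≈⟨ +-congˡ (u⊛-cong (G (suc n)) (G n) j λ i i≤j → stable n i (ℕₚ.≤-trans i≤j j≤n)) ⟩
      0# + (u ⊛ G n) (suc j)          ≈⟨ coeff≈ (horner n) (suc j) ⟨
      G (suc n) (suc j)               ∎

    stable′ : ∀ d i → G (d ℕ.+ i) i ≈ G i i
    stable′ zero    i = refl
    stable′ (suc d) i = trans (stable (d ℕ.+ i) i (ℕₚ.m≤n+m i d)) (stable′ d i)

    diagonal : ∀ i n → i ≤ n → (f ⁻¹) i ≈ G n i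
    diagonal i n i≤n = sym (≡.subst (λ k → G k i ≈ G i i) (ℕₚ.m∸n+n≡m i≤n) (stable′ (n ∸ i) i))

    fixpoint : f ⁻¹ ≋ 𝕊.1# 𝕊.+ u ⊛ f ⁻¹
    fixpoint = coeffwise λ where
      zero    → trans (diagonal 0 1 z≤n)
               (trans (coeff≈ (horner 0) 0)
                      (+-congˡ (trans (u⊛-at0 (G 0)) (sym (u⊛-at0 (f ⁻¹))))))
      (suc n) → trans (coeff≈ (horner n) (suc n))
                      (+-congˡ (u⊛-cong (G n) (f ⁻¹) n λ i i≤n → sym (diagonal i n i≤n)))

  -- The truncation after level d of the continued fraction
  --   1 / (1 - b₀z - λ₁z² / (1 - b₁z - λ₂z² / (1 - b₂z - ⋯))).
  -- The argument l 0 is never used.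
  jFraction : (b l : ℕ → Carrier) → ℕ → Series
  jFraction b l zero    = (𝕊.1# 𝕊.- constₛ (b 0) ⊛ z) ⁻¹
  jFraction b l (suc d) =
    (𝕊.1# 𝕊.- constₛ (b 0) ⊛ z
          𝕊.- constₛ (l 1) ⊛ z ^ 2 ⊛ jFraction (λ n → b (suc n)) (λ n → l (suc n)) d) ⁻¹

  -- All reciprocals occurring in jFraction are of series with constant coefficient 1.
  jFraction-equation₀ : ∀ b l →
    (𝕊.1# 𝕊.- constₛ (b 0) ⊛ z) ⊛ jFraction b l 0 ≋ 𝕊.1#
  jFraction-equation₀ b l = ⁻¹-inverseʳ _ (begin
    1# + - (b 0 * 0# + 0#)  ≈⟨ +-congˡ (-‿cong (trans (+-identityʳ _) (zeroʳ _))) ⟩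
    1# + - 0#               ≈⟨ +-congˡ -0#≈0# ⟩
    1# + 0#                 ≈⟨ +-identityʳ 1# ⟩
    1#                      ∎)

  jFraction-equation : ∀ b l d →
    (𝕊.1# 𝕊.- constₛ (b 0) ⊛ z
          𝕊.- constₛ (l 1) ⊛ z ^ 2 ⊛ jFraction (λ n → b (suc n)) (λ n → l (suc n)) d)
      ⊛ jFraction b l (suc d) ≋ 𝕊.1#
  jFraction-equation b l d = ⁻¹-inverseʳ _ (begin
    1# + - (b 0 * 0# + 0#) + - ((l 1 * (0# * _ + 0#) + 0#) * _ + 0#)
      ≈⟨ +-cong (+-congˡ (-‿cong (trans (+-identityʳ _) (zeroʳ _))))
                (-‿cong (trans (+-identityʳ _) (trans (*-congʳ (trans (+-identityʳ _)
                  (trans (*-congˡ (trans (+-identityʳ _) (zeroˡ _))) (zeroʳ _)))) (zeroˡ _)))) ⟩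
    1# + - 0# + - 0#  ≈⟨ +-cong (+-congˡ -0#≈0#) -0#≈0# ⟩
    1# + 0# + 0#      ≈⟨ trans (+-identityʳ _) (+-identityʳ 1#) ⟩
    1#                ∎)

module Polynomials {c ℓ : Level} (R : CommutativeRing c ℓ) where

  open CommutativeRing R hiding (zero)
  open RingProperties ring using (-0#≈0#)
  open Sum semiring
  open PowerSeries R using (_⊛_; constₛ; coeffwise; rawRing-series; isCommutativeRing-series)
    renaming (_≋_ to _≋ₛ_; coeff≈ to coeff≈ₛ)

  -- Finitely supported coefficient sequences.
  record Poly : Set (c ⊔ ℓ) where
    constructor mkPoly
    field
      coeff     : ℕ → Carrier
      bound     : ℕ
      vanishing : ∀ n → bound ≤ n → coeff n ≈ 0#

  open Poly public

  infix 4 _≈ₚ_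

  -- Polynomials with equal coefficients are equal, whatever their bounds.
  record _≈ₚ_ (p q : Poly) : Set ℓ where
    constructor coeffwiseₚ
    field coeff≈ₚ : coeff p ≋ₛ coeff q

  open _≈ₚ_ public

  const : Carrier → Poly
  const r = mkPoly (constₛ r) 1 λ { (suc n) _ → refl }

  X : Poly
  X = mkPoly (λ { zero → 0# ; (suc zero) → 1# ; (suc (suc n)) → 0# }) 2
             λ { (suc (suc n)) _ → refl ; (suc zero) (s≤s ()) }

  private
    ⊛-vanishing : ∀ p q n → bound p ℕ.+ bound q ≤ n → (coeff p ⊛ coeff q) n ≈ 0#
    ⊛-vanishing p q n p+q≤n =
      trans (sum-cong-≋ {suc n} (λ i → term (toℕ i))) (sum-replicate-zero (suc n))
      where
      term : ∀ i → coeff p i * coeff q (n ∸ i) ≈ 0#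
      term i with bound p ℕₚ.≤? i
      ... | yes bp≤i = trans (*-congʳ (vanishing p i bp≤i)) (zeroˡ _)
      ... | no  bp≰i = trans (*-congˡ (vanishing q (n ∸ i) bq≤n∸i)) (zeroʳ _)
        where
        bq≤n∸i : bound q ≤ n ∸ i
        bq≤n∸i = ℕₚ.m+n≤o⇒m≤o∸n (bound q)
          (ℕₚ.≤-trans (ℕₚ.+-monoʳ-≤ (bound q) (ℕₚ.<⇒≤ (ℕₚ.≰⇒> bp≰i)))
            (≡.subst (_≤ n) (ℕₚ.+-comm (bound p) (bound q)) p+q≤n))

  infixl 6 _+ₚ_
  infixl 7 _*ₚ_

  _+ₚ_ : Poly → Poly → Poly
  p +ₚ q = mkPoly (λ n → coeff p n + coeff q n) (bound p ℕ.⊔ bound q) λ n b≤n →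
    trans (+-cong (vanishing p n (ℕₚ.≤-trans (ℕₚ.m≤m⊔n (bound p) (bound q)) b≤n))
                  (vanishing q n (ℕₚ.≤-trans (ℕₚ.m≤n⊔m (bound p) (bound q)) b≤n)))
          (+-identityˡ 0#)

  _*ₚ_ : Poly → Poly → Poly
  p *ₚ q = mkPoly (coeff p ⊛ coeff q) (bound p ℕ.+ bound q) (⊛-vanishing p q)

  -ₚ_ : Poly → Poly
  -ₚ p = mkPoly (λ n → - coeff p n) (bound p) λ n b≤n →
    trans (-‿cong (vanishing p n b≤n)) -0#≈0#

  0ₚ : Poly
  0ₚ = mkPoly (λ _ → 0#) 0 λ _ _ → refl

  rawRing-poly : RawRing (c ⊔ ℓ) ℓ
  rawRing-poly = record
    { Carrier = Poly
    ; _≈_     = _≈ₚ_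
    ; _+_     = _+ₚ_
    ; _*_     = _*ₚ_
    ; -_      = -ₚ_
    ; 0#      = 0ₚ
    ; 1#      = const 1#
    }

  private
    coeff-isRingMonomorphism : IsRingMonomorphism rawRing-poly rawRing-series coeff
    coeff-isRingMonomorphism = record
      { isRingHomomorphism = record
        { isSemiringHomomorphism = record
          { isNearSemiringHomomorphism = record
            { +-isMonoidHomomorphism = record
              { isMagmaHomomorphism = record
                { isRelHomomorphism = record { cong = coeff≈ₚ }
                ; homo = λ p q → coeffwise λ n → refl
                }
              ; ε-homo = coeffwise λ n → refl
              }
            ; *-homo = λ p q → coeffwise λ n → refl
            }
          ; 1#-homo = coeffwise λ n → refl
          }
        ; -‿homo = λ p → coeffwise λ n → refl
        }
      ; injective = coeffwiseₚ
      }

  polyRing : CommutativeRing (c ⊔ ℓ) ℓ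
  polyRing = record
    { isCommutativeRing =
        RingMonomorphism.isCommutativeRing coeff-isRingMonomorphism isCommutativeRing-series
    }

module Determinants {a ℓ : Level} (A : CommutativeRing a ℓ) where

  open CommutativeRing A hiding (zero)
  open Sum semiring
  open Exp semiring using (_^_)

  -- Laplace expansion along the first row.
  det : ∀ {n} → (Fin n → Fin n → Carrier) → Carrier
  det {zero}  M = 1#
  det {suc n} M =
    ∑[ j < suc n ] ((- 1#) ^ toℕ j * M zero j * det (λ i k → M (suc i) (punchIn j k)))

  hankel : (ℕ → Carrier) → ℕ → Carrier
  hankel s n = det {suc n} λ i j → s (toℕ i ℕ.+ toℕ j)

module TannyDowling {c ℓ : Level} (R : CommutativeRing c ℓ) (m : CommutativeRing.Carrier R) where

  open Polynomials R

  private
    module R where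
      open CommutativeRing R public
      open Sum semiring public
      open Mult semiring public using (_×_)
      open Exp semiring public using (_^_)
    module R[x] where
      open CommutativeRing polyRing public
      open Sum semiring public
      open Mult semiring public using (_×_)
      open Exp semiring public using (_^_)

  -- The sum over k ≤ i ≤ n of (n C i) m^(i-k) S(i,k), reindexed by i = k + j
  -- (and empty when k > n).
  W : ℕ → ℕ → R.Carrier
  W n k = R.sum {suc n ∸ k} λ j →
    ((n C (k ℕ.+ toℕ j)) ℕ.* stirling₂ (k ℕ.+ toℕ j) k) R.× (m R.^ toℕ j)

  𝓕 : ℕ → Poly
  𝓕 n = R[x].sum {suc n} λ k →
    ((toℕ k !) R[x].× const (W n (toℕ k))) R[x].* (X R[x].^ toℕ k)

{-# OPTIONS --safe #-}

-- Let H be the table of Motzkin path counts with level weights b and down weights l.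
-- Its zeroth column has the J-fraction as generating function: μ = 1 + b₀ z μ + l₁ z² μ′ μ, where μ′
-- belongs to the shifted weights.  Its Hankel matrix is H D Hᵀ with H lower unitriangular and D the
-- diagonal matrix of the products l₁ ⋯ l_k, so the determinant is the product of these.
-- It remains to see that 𝓕 is the zeroth column.  The recurrence of the Whitney numbers says that
-- ∑ⱼ W(n,j) vⱼ = (Tⁿ v)₀ with (T v)ⱼ = (1 + j m) vⱼ + vⱼ₊₁, and the vectors
-- (j! / k!) (j choose k) x^(j - k), k = 0, 1, …, form a basis in which T is tridiagonal with weights b, l.
module Submission where

open import Defs
open import Algebra.Bundles using (CommutativeRing; Semiring)
open import Algebra.Definitions.RawSemiring using (product)
import Algebra.Properties.CommutativeMonoid.Sum as CommutativeMonoidSum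
import Algebra.Properties.Ring as RingProperties
import Algebra.Properties.Semiring.Exp as Exp
import Algebra.Properties.Semiring.Mult as Mult
import Algebra.Properties.Semiring.Sum as Sum
import Algebra.Solver.Ring.NaturalCoefficients.Default as NaturalCoefficients
open import Data.Fin.Base using (Fin; zero; suc; toℕ; punchIn)
open import Data.Fin.Properties using (toℕ≤pred[n])
open import Data.Nat.Base as ℕ using (ℕ; zero; suc; _!; _∸_; _≤_; _<_; z≤n; s≤s)
open import Data.Nat.Combinatorics using (_C_; k>n⇒nCk≡0; nCk+nC[k+1]≡[n+1]C[k+1]; nC1≡n)
import Data.Nat.Properties as ℕₚ
import Data.Nat.Solver as ℕSolver
open import Data.Product.Base using (_×_; _,_)
open import Data.Sum.Base using (inj₁; inj₂)
open import Data.Vec.Base using (Vec; []; _∷_; tabulate)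
open import Data.Vec.Properties using (tabulate-cong)
open import Level using (Level; _⊔_; Lift; lift)
open import Data.Unit.Base using (⊤; tt)
import Relation.Binary.PropositionalEquality as ≡
open ≡ using (_≡_)

-- The factor Hᵀ is never formed. Multiplying H D by it amounts to column operations: the Hankel
-- columns are the successive shifts of one column, and each shift is the next column of H D modulo
-- the earlier ones. An alternating form does not see such operations, which is why the determinant
-- is rewritten as an alternating form in infinite columns. The vectors that make T tridiagonal are
-- introduced as path counts for the weights (2k + 1) x and k² x², not by their closed form with its
-- quotient j! / k!. The coordinate shift is then tridiagonal by definition. The rest of T is the
-- identity plus m times multiplication by the index j, and the latter sends the k-th vector to k
-- times itself plus (k + 1)² x times the next. Adding up gives the level weight (2k + 1) x + k m +
-- 1 and the down weight k² x² + k² x m = k² x (x + m), the origin of the b and λ of the theorem.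

module LinearMaps {a ℓ : Level} (A : CommutativeRing a ℓ) where

  open CommutativeRing A hiding (zero)
  open RingProperties ring using (-‿distribʳ-*; -‿+-comm)
  open NaturalCoefficients commutativeSemiring using (solve; _:=_; _:+_; _:*_)
  open import Relation.Binary.Reasoning.Setoid setoid

  Column : Set a
  Column = ℕ → Carrier

  record Linear (f : Column → Carrier) : Set (a ⊔ ℓ) where
    field
      cong  : ∀ {u v} → (∀ i → u i ≈ v i) → f u ≈ f v
      add   : ∀ u v → f (λ i → u i + v i) ≈ f u + f v
      scale : ∀ s u → f (λ i → s * u i) ≈ s * f u

  open Linear public

  Linear-coordinate : ∀ i s → Linear (λ v → v i * s)
  Linear-coordinate i s = record
    { cong  = λ p → *-congʳ (p i)
    ; add   = λ u v → distribʳ s (u i) (v i)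
    ; scale = λ t u → *-assoc t (u i) s
    }

  Linear-* : ∀ {f} s → Linear f → Linear (λ v → s * f v)
  Linear-* s lin = record
    { cong  = λ p → *-congˡ (cong lin p)
    ; add   = λ u v → trans (*-congˡ (add lin u v)) (distribˡ _ _ _)
    ; scale = λ t u → trans (*-congˡ (scale lin t u))
        (solve 3 (λ s t x → s :* (t :* x) := t :* (s :* x)) refl s t _)
    }

  Linear-- : ∀ {f g} → Linear f → Linear g → Linear (λ v → f v - g v)
  Linear-- {f} {g} lf lg = record
    { cong  = λ p → +-cong (cong lf p) (-‿cong (cong lg p))
    ; add   = λ u v → begin
        f (λ i → u i + v i) - g (λ i → u i + v i)
          ≈⟨ +-cong (add lf u v) (trans (-‿cong (add lg u v)) (sym (-‿+-comm _ _))) ⟩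
        (f u + f v) + (- g u + - g v)
          ≈⟨ solve 4 (λ w x y z → (w :+ x) :+ (y :+ z) := (w :+ y) :+ (x :+ z)) refl _ _ _ _ ⟩
        (f u - g u) + (f v - g v) ∎
    ; scale = λ t u → begin
        f (λ i → t * u i) - g (λ i → t * u i)
          ≈⟨ +-cong (scale lf t u) (trans (-‿cong (scale lg t u)) (-‿distribʳ-* _ _)) ⟩
        t * f u + t * (- g u)
          ≈⟨ distribˡ _ _ _ ⟨
        t * (f u - g u) ∎
    }

  shift : ℕ → Column → Column
  shift i v j = v (i ℕ.+ j)

-- Determinants as alternating forms in their columns.

module ExteriorDeterminant {a ℓ : Level} (A : CommutativeRing a ℓ) where

  open CommutativeRing A hiding (zero)
  open RingProperties ring using (-1*x≈-x; -0#≈0#)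
  open Sum semiring
  open Exp semiring using (_^_)
  open Determinants A using (det)
  open LinearMaps A
  open import Relation.Binary.Reasoning.Setoid setoid

  Form : ℕ → Set a
  Form n = Vec Column n → Carrier

  -- Interior product of φ with the r-th coordinate functional.
  contract : ∀ {n} → ℕ → Form n → Form (suc n)
  contract {zero}  r φ (c ∷ cs) = c r * φ cs
  contract {suc n} r φ (c ∷ cs) = c r * φ cs - contract r (λ ds → φ (c ∷ ds)) cs

  -- The minor on rows r, ..., r + n - 1, by Laplace expansion along row r. Columns are infinite, so
  -- passing to a smaller minor only raises the first row and deletes a column.
  volume : ∀ n → ℕ → Form n
  volume zero    r _ = 1#
  volume (suc n) r   = contract r (volume n (suc r))

  -- In the summands with j > 0 the first column stays in front and one factor -1 comes out; this is
  -- the recursion of `contract`.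
  contract-tabulate : ∀ n r (φ : Form n) (c : Fin (suc n) → Column) →
    ∑[ j < suc n ] ((- 1#) ^ toℕ j * c j r * φ (tabulate (λ k → c (punchIn j k)))) ≈
    contract r φ (tabulate c)
  contract-tabulate zero    r φ c = trans (+-identityʳ _) (*-congʳ (*-identityˡ _))
  contract-tabulate (suc n) r φ c = +-cong (*-congʳ (*-identityˡ _)) (begin
    ∑[ j < suc n ] ((- 1#) * (- 1#) ^ toℕ j * c (suc j) r * φ (c zero ∷ rest j))
      ≈⟨ sum-cong-≋ {suc n} (λ j → trans (*-congʳ (*-assoc (- 1#) ((- 1#) ^ toℕ j) (c (suc j) r)))
                                         (*-assoc (- 1#) ((- 1#) ^ toℕ j * c (suc j) r) (φ (c zero ∷ rest j)))) ⟩
    ∑[ j < suc n ] ((- 1#) * ((- 1#) ^ toℕ j * c (suc j) r * φ (c zero ∷ rest j)))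
      ≈⟨ *-distribˡ-sum {suc n} (- 1#) (λ j → (- 1#) ^ toℕ j * c (suc j) r * φ (c zero ∷ rest j)) ⟨
    (- 1#) * ∑[ j < suc n ] ((- 1#) ^ toℕ j * c (suc j) r * φ (c zero ∷ rest j))
      ≈⟨ -1*x≈-x _ ⟩
    - ∑[ j < suc n ] ((- 1#) ^ toℕ j * c (suc j) r * φ (c zero ∷ rest j))
      ≈⟨ -‿cong (contract-tabulate n r (λ ds → φ (c zero ∷ ds)) (λ j → c (suc j))) ⟩
    - contract r (λ ds → φ (c zero ∷ ds)) (tabulate (λ j → c (suc j))) ∎)
    where
    rest : Fin (suc n) → Vec Column n
    rest j = tabulate (λ k → c (suc (punchIn j k)))

  det≈volume : ∀ n r (M : Fin n → Fin n → Carrier) (c : Fin n → Column) →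
    (∀ i k → M i k ≈ c k (r ℕ.+ toℕ i)) → det M ≈ volume n r (tabulate c)
  det≈volume zero    r M c p = refl
  det≈volume (suc n) r M c p = trans
    (sum-cong-≋ {suc n} λ j → *-cong
      (*-congˡ {(- 1#) ^ toℕ j} (trans (p zero j) (reflexive (≡.cong (c j) (ℕₚ.+-identityʳ r)))))
      (det≈volume n (suc r) _ (λ k → c (punchIn j k)) λ i k →
        trans (p (suc i) (punchIn j k)) (reflexive (≡.cong (c (punchIn j k)) (ℕₚ.+-suc r (toℕ i))))))
    (contract-tabulate n r (volume n (suc r)) c)

  -- Only the first argument is tested, and the condition is vacuous without arguments; `Kills-∷`
  -- carries it to later positions.
  Kills : ∀ {n} → Column → Form n → Set (a ⊔ ℓ)
  Kills {zero}  v φ = Lift (a ⊔ ℓ) ⊤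
  Kills {suc n} v φ = Lift a (∀ cs → φ (v ∷ cs) ≈ 0#)

  -- Each layer speaks of the first one or two arguments and recurs with the first one fixed, which
  -- covers linearity in every argument and all pairs of adjacent arguments. Vanishing on equal
  -- arguments replaces a change of sign, since the ring may have characteristic 2.
  data Alternating : ∀ {n} → Form n → Set (a ⊔ ℓ) where
    nil  : {φ : Form 0} → Alternating φ
    cons : ∀ {n} {φ : Form (suc n)} →
           (∀ cs → Linear (λ v → φ (v ∷ cs))) →
           (∀ v → Kills v (λ cs → φ (v ∷ cs))) →
           (∀ v → Alternating (λ cs → φ (v ∷ cs))) →
           Alternating φ

  private
    x-0≈x : ∀ {x y} → y ≈ 0# → x - y ≈ x
    x-0≈x y≈0 = trans (+-congˡ (trans (-‿cong y≈0) -0#≈0#)) (+-identityʳ _)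

    0-0≈0 : ∀ {x y} → x ≈ 0# → y ≈ 0# → x - y ≈ 0#
    0-0≈0 x≈0 y≈0 = trans (x-0≈x y≈0) x≈0

    *-zeroʳ : ∀ {s x} → x ≈ 0# → s * x ≈ 0#
    *-zeroʳ x≈0 = trans (*-congˡ x≈0) (zeroʳ _)

  Kills-*-- : ∀ {n} {φ ψ : Form n} s v → Kills v φ → Kills v ψ → Kills v (λ cs → s * φ cs - ψ cs)
  Kills-*-- {zero}  s v _ _ = lift tt
  Kills-*-- {suc n} s v (lift p) (lift q) = lift λ cs → 0-0≈0 (*-zeroʳ (p cs)) (q cs)

  Alternating-*-- : ∀ {n} {φ ψ : Form n} s → Alternating φ → Alternating ψ →
                    Alternating (λ cs → s * φ cs - ψ cs)
  Alternating-*-- s nil nil = nil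
  Alternating-*-- s (cons lin kill alt) (cons lin′ kill′ alt′) = cons
    (λ cs → Linear-- (Linear-* s (lin cs)) (lin′ cs))
    (λ v → Kills-*-- s v (kill v) (kill′ v))
    (λ v → Alternating-*-- s (alt v) (alt′ v))

  contract-zero : ∀ {n} r (φ : Form n) → (∀ cs → φ cs ≈ 0#) → ∀ cs → contract r φ cs ≈ 0#
  contract-zero {zero}  r φ p (c ∷ cs) = *-zeroʳ (p cs)
  contract-zero {suc n} r φ p (c ∷ cs) =
    0-0≈0 (*-zeroʳ (p cs)) (contract-zero r _ (λ ds → p (c ∷ ds)) cs)

  Linear-contract : ∀ {n} r (φ : Column → Form n) → (∀ cs → Linear (λ v → φ v cs)) →
                    ∀ cs → Linear (λ v → contract r (φ v) cs)
  Linear-contract {zero}  r φ lin (c ∷ cs) = Linear-* (c r) (lin cs)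
  Linear-contract {suc n} r φ lin (c ∷ cs) =
    Linear-- (Linear-* (c r) (lin cs)) (Linear-contract r (λ v ds → φ v (c ∷ ds)) (λ ds → lin (c ∷ ds)) cs)

  Alternating-contract : ∀ {n} r {φ : Form n} → Alternating φ → Alternating (contract r φ)
  Alternating-contract r {φ} nil = cons (λ { [] → Linear-coordinate r (φ []) }) (λ v → lift tt) (λ v → nil)
  Alternating-contract r {φ} (cons lin kill alt) = cons
    (λ cs → Linear-- (Linear-coordinate r (φ cs)) (Linear-contract r (λ v ds → φ (v ∷ ds)) lin cs))
    (λ v → lift (repeated {φ = φ} v kill))
    (λ v → Alternating-*-- (v r) (cons lin kill alt) (Alternating-contract r (alt v)))
    where
    -- The two leading arguments contribute `v r * φ (v ∷ cs)` with opposite signs; what remains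
    -- contracts `φ (v ∷ v ∷ _)`, which is zero.
    repeated : ∀ {n} {φ : Form (suc n)} v → (∀ v → Kills v (λ cs → φ (v ∷ cs))) → ∀ cs →
               contract r φ (v ∷ v ∷ cs) ≈ 0#
    repeated {zero}  v kill []  = -‿inverseʳ _
    repeated {suc n} v kill cs = trans
      (+-congˡ (-‿cong (x-0≈x (contract-zero r _ (λ ds → Level.lower (kill v) ds) cs)))) (-‿inverseʳ _)

  Alternating-volume : ∀ n r → Alternating (volume n r)
  Alternating-volume zero    r = nil
  Alternating-volume (suc n) r = Alternating-contract r (Alternating-volume n (suc r))

  -- Polarisation: φ (c, b) is padded by the vanishing values φ (c, c) and φ (b, c + b) until it
  -- becomes φ (c + b, c + b).
  Kills-∷ : ∀ {n} {φ : Form (suc n)} b c → Alternating φ → Kills b φ → Kills b (λ cs → φ (c ∷ cs))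
  Kills-∷ {zero}      b c _ _ = lift tt
  Kills-∷ {suc n} {φ} b c (cons lin kill alt) (lift kb) = lift λ cs → begin
    φ (c ∷ b ∷ cs)                          ≈⟨ +-identityˡ _ ⟨
    0# + φ (c ∷ b ∷ cs)                     ≈⟨ +-congʳ (Level.lower (kill c) cs) ⟨
    φ (c ∷ c ∷ cs) + φ (c ∷ b ∷ cs)         ≈⟨ second c cs ⟨
    φ (c ∷ c+b ∷ cs)                        ≈⟨ +-identityʳ _ ⟨
    φ (c ∷ c+b ∷ cs) + 0#                   ≈⟨ +-congˡ (kb (c+b ∷ cs)) ⟨
    φ (c ∷ c+b ∷ cs) + φ (b ∷ c+b ∷ cs)     ≈⟨ add (lin (c+b ∷ cs)) c b ⟨
    φ (c+b ∷ c+b ∷ cs)                      ≈⟨ Level.lower (kill c+b) cs ⟩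
    0#                                      ∎
    where
    c+b : Column
    c+b i = c i + b i
    second : ∀ v cs → φ (v ∷ c+b ∷ cs) ≈ φ (v ∷ c ∷ cs) + φ (v ∷ b ∷ cs)
    second v cs with alt v
    ... | cons lin′ _ _ = add (lin′ cs) c b

  segment : (ℕ → Column) → ℕ → ∀ n → Vec Column n
  segment B r zero    = []
  segment B r (suc n) = B r ∷ segment B (suc r) n

  tabulate≡segment : ∀ B r n → tabulate {n = n} (λ i → B (r ℕ.+ toℕ i)) ≡ segment B r n
  tabulate≡segment B r zero    = ≡.refl
  tabulate≡segment B r (suc n) = ≡.cong₂ _∷_ (≡.cong B (ℕₚ.+-identityʳ r))
    (≡.trans (tabulate-cong (λ i → ≡.cong B (ℕₚ.+-suc r (toℕ i)))) (tabulate≡segment B (suc r) n))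

  -- The hypothesis says that N r ∈ B r + span (B 0, …, B (r - 1)).
  eliminate : ∀ (N B : ℕ → Column) →
    (∀ r {f} → Linear f → (∀ k → k < r → f (B k) ≈ 0#) → f (N r) ≈ f (B r)) →
    ∀ n r {φ : Form n} → Alternating φ → (∀ k → k < r → Kills (B k) φ) →
    φ (segment N r n) ≈ φ (segment B r n)
  eliminate N B unitri zero    r alt kill = refl
  eliminate N B unitri (suc n) r {φ} alt₀@(cons lin self alt) kill = trans
    (unitri r (lin (segment N (suc r) n)) (λ k k<r → Level.lower (kill k k<r) _))
    -- With `B r` in front, the form in the remaining arguments kills `B r` as well, so the next
    -- column may be reduced modulo it.
    (eliminate N B unitri n (suc r) (alt (B r)) killed)
    where
    killed : ∀ k → k < suc r → Kills (B k) (λ cs → φ (B r ∷ cs))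
    killed k (s≤s k≤r) with ℕₚ.m≤n⇒m<n∨m≡n k≤r
    ... | inj₁ k<r    = Kills-∷ (B k) (B r) alt₀ (kill k k<r)
    ... | inj₂ ≡.refl = self (B r)

  diagonalProduct : (ℕ → Carrier) → ℕ → ℕ → Carrier
  diagonalProduct d r zero    = 1#
  diagonalProduct d r (suc n) = d r * diagonalProduct d (suc r) n

  contract-segment : ∀ (B : ℕ → Column) r n k (φ : Form n) → (∀ j → k ≤ j → B j r ≈ 0#) →
                     contract r φ (segment B k (suc n)) ≈ 0#
  contract-segment B r zero    k φ p = trans (*-congʳ (p k ℕₚ.≤-refl)) (zeroˡ _)
  contract-segment B r (suc n) k φ p = 0-0≈0
    (trans (*-congʳ (p k ℕₚ.≤-refl)) (zeroˡ _))
    (contract-segment B r n (suc k) _ (λ j k<j → p j (ℕₚ.<⇒≤ k<j)))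

  -- In row r of the columns r, r + 1, ... only the first entry can be nonzero, so each expansion
  -- keeps a single summand.
  volume-triangular : ∀ (B : ℕ → Column) (d : ℕ → Carrier) →
    (∀ k i → i < k → B k i ≈ 0#) → (∀ k → B k k ≈ d k) →
    ∀ n r → volume n r (segment B r n) ≈ diagonalProduct d r n
  volume-triangular B d low diag zero          r = refl
  volume-triangular B d low diag (suc zero)    r = *-congʳ (diag r)
  volume-triangular B d low diag (suc (suc n)) r = trans
    (x-0≈x (contract-segment B r n (suc r) _ (λ j r<j → low j r r<j)))
    (*-cong (diag r) (volume-triangular B d low diag (suc n) (suc r)))

module Reciprocal {a ℓ : Level} (A : CommutativeRing a ℓ) where

  open CommutativeRing A
  open NaturalCoefficients commutativeSemiring using (solve; _:=_; _:+_; _:*_)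
  open import Relation.Binary.Reasoning.Setoid setoid

  -- Freed of subtraction, the equation for one level of the fraction has the shape of a path
  -- recurrence.
  unfold : ∀ p q x → (1# - p - q) * x ≈ 1# → x ≈ 1# + (p * x + q * x)
  unfold p q x eq = sym (begin
    1# + (p * x + q * x)                    ≈⟨ +-congʳ eq ⟨
    (1# - p - q) * x + (p * x + q * x)
      ≈⟨ solve 6 (λ u p p′ q q′ x → (u :+ p′ :+ q′) :* x :+ (p :* x :+ q :* x) :=
                                    (u :+ ((p :+ p′) :+ (q :+ q′))) :* x) refl 1# p (- p) q (- q) x ⟩
    (1# + ((p - p) + (q - q))) * x
      ≈⟨ *-congʳ (+-congˡ (trans (+-cong (-‿inverseʳ p) (-‿inverseʳ q)) (+-identityʳ 0#))) ⟩
    (1# + 0#) * x                           ≈⟨ *-congʳ (+-identityʳ 1#) ⟩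
    1# * x                                  ≈⟨ *-identityˡ x ⟩
    x                                       ∎)

-- Weighted Motzkin paths and the Hankel determinants of their counts.

module StieltjesTable {a ℓ : Level} (A : CommutativeRing a ℓ) where

  open CommutativeRing A hiding (zero)
  open NaturalCoefficients commutativeSemiring using (solve; _:=_; _:+_; _:*_; con)
  open PowerSeries A
  open Determinants A
  open LinearMaps A
  open ExteriorDeterminant A
  open Sum semiring
  open import Relation.Binary.Reasoning.Setoid setoid

  -- Weighted count of Motzkin paths of length n from height 0 to height k:
  -- level steps at height h weigh b h, steps down from height h weigh l h.
  path : (b l : ℕ → Carrier) → ℕ → ℕ → Carrier
  path b l zero    zero    = 1#
  path b l zero    (suc k) = 0#
  path b l (suc n) zero    = b 0 * path b l n 0 + l 1 * path b l n 1
  path b l (suc n) (suc k) =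
    path b l n k + b (suc k) * path b l n (suc k) + l (suc (suc k)) * path b l n (suc (suc k))

  path-cong : ∀ {b b′ l l′} → (∀ k → b k ≈ b′ k) → (∀ k → l k ≈ l′ k) →
              ∀ n k → path b l n k ≈ path b′ l′ n k
  path-cong p q zero    zero    = refl
  path-cong p q zero    (suc k) = refl
  path-cong p q (suc n) zero    =
    +-cong (*-cong (p 0) (path-cong p q n 0)) (*-cong (q 1) (path-cong p q n 1))
  path-cong p q (suc n) (suc k) = +-cong
    (+-cong (path-cong p q n k) (*-cong (p (suc k)) (path-cong p q n (suc k))))
    (*-cong (q (suc (suc k))) (path-cong p q n (suc (suc k))))

  path-high : ∀ b l n k → n < k → path b l n k ≈ 0#
  path-high b l zero    (suc k) _         = refl
  path-high b l (suc n) (suc k) (s≤s n<k) = begin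
    path b l n k + b (suc k) * path b l n (suc k) + l (suc (suc k)) * path b l n (suc (suc k))
      ≈⟨ +-cong (+-cong (path-high b l n k n<k) (*-congˡ (path-high b l n (suc k) n<k+1)))
                (*-congˡ (path-high b l n (suc (suc k)) (ℕₚ.m≤n⇒m≤1+n n<k+1))) ⟩
    0# + b (suc k) * 0# + l (suc (suc k)) * 0#
      ≈⟨ solve 2 (λ x y → con 0 :+ x :* con 0 :+ y :* con 0 := con 0) refl _ _ ⟩
    0# ∎
    where n<k+1 = ℕₚ.m≤n⇒m≤1+n n<k

  path-diagonal : ∀ b l n → path b l n n ≈ 1#
  path-diagonal b l zero    = refl
  path-diagonal b l (suc n) = begin
    path b l n n + b (suc n) * path b l n (suc n) + l (suc (suc n)) * path b l n (suc (suc n))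
      ≈⟨ +-cong (+-cong (path-diagonal b l n) (*-congˡ (path-high b l n (suc n) ℕₚ.≤-refl)))
                (*-congˡ (path-high b l n (suc (suc n)) (ℕₚ.m≤n⇒m≤1+n ℕₚ.≤-refl))) ⟩
    1# + b (suc n) * 0# + l (suc (suc n)) * 0#
      ≈⟨ solve 2 (λ x y → con 1 :+ x :* con 0 :+ y :* con 0 := con 1) refl _ _ ⟩
    1# ∎

  -- The weight of the straight descent from height k to 0. Reversing a path from 0 to k multiplies
  -- its weight by this, as each height from 1 to k is entered from below once more than it is left
  -- downwards.
  downWeight : (ℕ → Carrier) → ℕ → Carrier
  downWeight l zero    = 1#
  downWeight l (suc k) = l (suc k) * downWeight l k

  module _ (b l : ℕ → Carrier) where

    -- Paths from height k to height 0, counted by length.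
    column : ℕ → Column
    column k n = downWeight l k * path b l n k

    -- Decomposition by the first step. A step up weighs 1, so here and in `shift-column-suc` the
    -- next column enters with coefficient 1.
    shift-column-zero : ∀ n → column 0 (suc n) ≈ b 0 * column 0 n + column 1 n
    shift-column-zero n = solve 4 (λ b l s t →
      con 1 :* (b :* s :+ l :* t) := b :* (con 1 :* s) :+ (l :* con 1) :* t) refl _ _ _ _

    shift-column-suc : ∀ k n →
      column (suc k) (suc n) ≈ l (suc k) * column k n + (b (suc k) * column (suc k) n + column (suc (suc k)) n)
    shift-column-suc k n = solve 7 (λ d l l′ b r s t →
      (l :* d) :* (r :+ b :* s :+ l′ :* t) :=
      l :* (d :* r) :+ (b :* ((l :* d) :* s) :+ (l′ :* (l :* d)) :* t)) refl _ _ _ _ _ _ _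

    -- Iterating shift-column-zero and shift-column-suc, column j shifted i times is column (i + j) modulo
    -- the columns before it.
    shift-column : ∀ i j {f} → Linear f → (∀ k → k < i ℕ.+ j → f (column k) ≈ 0#) →
                   f (λ n → column j (i ℕ.+ n)) ≈ f (column (i ℕ.+ j))
    shift-column zero    j lin kill = refl
    shift-column (suc i) zero {f} lin kill = begin
      f (λ n → column 0 (suc i ℕ.+ n))
        ≈⟨ cong lin (λ n → shift-column-zero (i ℕ.+ n)) ⟩
      f (λ n → b 0 * column 0 (i ℕ.+ n) + column 1 (i ℕ.+ n))
        ≈⟨ trans (add lin _ _) (+-congʳ (scale lin _ _)) ⟩
      b 0 * f (shift i (column 0)) + f (shift i (column 1))
        ≈⟨ +-cong (*-congˡ (shift-column i 0 lin λ k k< → kill k (ℕₚ.m≤n⇒m≤1+n k<)))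
                  (shift-column i 1 lin λ k k< → kill k (≡.subst (k <_) (ℕₚ.+-suc i 0) k<)) ⟩
      b 0 * f (column (i ℕ.+ 0)) + f (column (i ℕ.+ 1))
        ≈⟨ +-cong (trans (*-congˡ (kill (i ℕ.+ 0) ℕₚ.≤-refl)) (zeroʳ _))
                  (reflexive (≡.cong (λ k → f (column k)) (ℕₚ.+-suc i 0))) ⟩
      0# + f (column (suc (i ℕ.+ 0)))
        ≈⟨ +-identityˡ _ ⟩
      f (column (suc (i ℕ.+ 0))) ∎
    shift-column (suc i) (suc j) {f} lin kill = begin
      f (λ n → column (suc j) (suc i ℕ.+ n))
        ≈⟨ cong lin (λ n → shift-column-suc j (i ℕ.+ n)) ⟩
      f (λ n → l (suc j) * column j (i ℕ.+ n) +
               (b (suc j) * column (suc j) (i ℕ.+ n) + column (suc (suc j)) (i ℕ.+ n)))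
        ≈⟨ trans (add lin _ _) (+-cong (scale lin _ _) (trans (add lin _ _) (+-congʳ (scale lin _ _)))) ⟩
      l (suc j) * f (shift i (column j)) +
        (b (suc j) * f (shift i (column (suc j))) + f (shift i (column (suc (suc j)))))
        ≈⟨ +-cong (*-congˡ (shift-column i j lin λ k k< → kill k (ℕₚ.<-trans k< i+j<)))
          (+-cong (*-congˡ (shift-column i (suc j) lin λ k k< → kill k (ℕₚ.m≤n⇒m≤1+n k<)))
                  (shift-column i (suc (suc j)) lin λ k k< → kill k (≡.subst (k <_) (ℕₚ.+-suc i (suc j)) k<))) ⟩
      l (suc j) * f (column (i ℕ.+ j)) +
        (b (suc j) * f (column (i ℕ.+ suc j)) + f (column (i ℕ.+ suc (suc j))))
        ≈⟨ +-cong (trans (*-congˡ (kill (i ℕ.+ j) i+j<)) (zeroʳ _))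
          (+-cong (trans (*-congˡ (kill (i ℕ.+ suc j) ℕₚ.≤-refl)) (zeroʳ _))
                  (reflexive (≡.cong (λ k → f (column k)) (ℕₚ.+-suc i (suc j))))) ⟩
      0# + (0# + f (column (suc (i ℕ.+ suc j))))
        ≈⟨ trans (+-identityˡ _) (+-identityˡ _) ⟩
      f (column (suc (i ℕ.+ suc j))) ∎
      where
      i+j< : i ℕ.+ j < suc (i ℕ.+ suc j)
      i+j< = s≤s (ℕₚ.+-monoʳ-≤ i (ℕₚ.n≤1+n j))

    -- Column j of the Hankel matrix is `column 0` shifted j times. Reduced modulo its predecessors
    -- it becomes `column j`, and these columns are lower triangular with diagonal `downWeight l`.
    hankel-path : ∀ (s : ℕ → Carrier) → (∀ n → s n ≈ path b l n 0) →
                  ∀ n → hankel s n ≈ diagonalProduct (downWeight l) 0 (suc n)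
    hankel-path s s≈ n = begin
      hankel s n
        ≈⟨ det≈volume (suc n) 0 _ (λ j i → s (toℕ j ℕ.+ i))
             (λ i j → reflexive (≡.cong s (ℕₚ.+-comm (toℕ i) (toℕ j)))) ⟩
      volume (suc n) 0 (tabulate {n = suc n} (λ j i → s (toℕ j ℕ.+ i)))
        ≡⟨ ≡.cong (volume (suc n) 0) (tabulate≡segment (λ j i → s (j ℕ.+ i)) 0 (suc n)) ⟩
      volume (suc n) 0 (segment (λ j i → s (j ℕ.+ i)) 0 (suc n))
        ≈⟨ eliminate (λ j i → s (j ℕ.+ i)) column unitriangular (suc n) 0 (Alternating-volume (suc n) 0) (λ _ ()) ⟩
      volume (suc n) 0 (segment column 0 (suc n))
        ≈⟨ volume-triangular column (downWeight l)
             (λ k i i<k → trans (*-congˡ (path-high b l i k i<k)) (zeroʳ _))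
             (λ k → trans (*-congˡ (path-diagonal b l k)) (*-identityʳ _)) (suc n) 0 ⟩
      diagonalProduct (downWeight l) 0 (suc n) ∎
      where
      unitriangular : ∀ r {f} → Linear f → (∀ k → k < r → f (column k) ≈ 0#) →
                      f (λ i → s (r ℕ.+ i)) ≈ f (column r)
      unitriangular r {f} lin kill = begin
        f (λ i → s (r ℕ.+ i))
          ≈⟨ cong lin (λ i → trans (s≈ (r ℕ.+ i)) (sym (*-identityˡ _))) ⟩
        f (λ i → column 0 (r ℕ.+ i))
          ≈⟨ shift-column r 0 lin (λ k k< → kill k (≡.subst (k <_) (ℕₚ.+-identityʳ r) k<)) ⟩
        f (column (r ℕ.+ 0))
          ≡⟨ ≡.cong (λ k → f (column k)) (ℕₚ.+-identityʳ r) ⟩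
        f (column r) ∎

  -- Generating functions of path counts and the J-fraction.

  private
    module 𝕊 = CommutativeRing seriesRing
    open Exp 𝕊.semiring using (_^_)

    sumTo-cong : ∀ n (t t′ : Fin n → Carrier) → (∀ i → t i ≈ t′ i) → sum t ≈ sum t′
    sumTo-cong n t t′ p = sum-cong-≋ {n} {t} {t′} p

  ⊛-cong-upTo : ∀ {f f′ g g′} n → (∀ i → i ≤ n → f i ≈ f′ i) → (∀ i → i ≤ n → g i ≈ g′ i) →
                (f ⊛ g) n ≈ (f′ ⊛ g′) n
  ⊛-cong-upTo {f} {f′} {g} {g′} n p q = sumTo-cong (suc n) (λ i → f (toℕ i) * g (n ∸ toℕ i)) (λ i → f′ (toℕ i) * g′ (n ∸ toℕ i)) λ i →
    *-cong (p (toℕ i) (toℕ≤pred[n] i)) (q (n ∸ toℕ i) (ℕₚ.m∸n≤m n (toℕ i)))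

  constₛ-⊛ : ∀ c f n → (constₛ c ⊛ f) n ≈ c * f n
  constₛ-⊛ c f zero    = +-identityʳ _
  constₛ-⊛ c f (suc n) = trans (+-congˡ (coeff≈ (𝕊.zeroˡ f) n)) (+-identityʳ _)

  z⊛-zero : ∀ f → (z ⊛ f) 0 ≈ 0#
  z⊛-zero f = trans (+-identityʳ _) (zeroˡ _)

  z⊛-suc : ∀ f n → (z ⊛ f) (suc n) ≈ f n
  z⊛-suc f n = begin
    0# * f (suc n) + ((λ i → z (suc i)) ⊛ f) n  ≈⟨ +-cong (zeroˡ _) (coeff≈ (𝕊.*-congʳ {f} tail-z) n) ⟩
    0# + (constₛ 1# ⊛ f) n                      ≈⟨ +-identityˡ _ ⟩
    (constₛ 1# ⊛ f) n                           ≈⟨ coeff≈ (𝕊.*-identityˡ f) n ⟩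
    f n                                         ∎
    where
    tail-z : (λ i → z (suc i)) ≋ constₛ 1#
    tail-z = coeffwise λ { zero → refl ; (suc i) → refl }

  z⊛-cong : ∀ f g n → (∀ i → i < n → f i ≈ g i) → (z ⊛ f) n ≈ (z ⊛ g) n
  z⊛-cong f g zero    p = trans (z⊛-zero f) (sym (z⊛-zero g))
  z⊛-cong f g (suc n) p = trans (z⊛-suc f n) (trans (p n ℕₚ.≤-refl) (sym (z⊛-suc g n)))

  ⊛-last : ∀ f g n → (f ⊛ g) (suc n) ≈ (f ⊛ (λ i → g (suc i))) n + f (suc n) * g 0
  ⊛-last f g n = begin
    (f ⊛ g) (suc n)                                           ≈⟨ coeff≈ (𝕊.*-comm f g) (suc n) ⟩
    g 0 * f (suc n) + ((λ i → g (suc i)) ⊛ f) n               ≈⟨ +-comm _ _ ⟩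
    ((λ i → g (suc i)) ⊛ f) n + g 0 * f (suc n)
      ≈⟨ +-cong (coeff≈ (𝕊.*-comm (λ i → g (suc i)) f) n) (*-comm _ _) ⟩
    (f ⊛ (λ i → g (suc i))) n + f (suc n) * g 0               ∎

  tail : (ℕ → Carrier) → ℕ → Carrier
  tail b n = b (suc n)

  moments : (b l : ℕ → Carrier) → Series
  moments b l n = path b l n 0

  ⊛-scaleʳ : ∀ f c g n → (f ⊛ (λ i → c * g i)) n ≈ c * (f ⊛ g) n
  ⊛-scaleʳ f c g n = trans
    (sumTo-cong (suc n) (λ i → f (toℕ i) * (c * g (n ∸ toℕ i))) (λ i → c * (f (toℕ i) * g (n ∸ toℕ i)))
      (λ i → solve 3 (λ x c y → x :* (c :* y) := c :* (x :* y)) refl _ _ _))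
    (sym (*-distribˡ-sum {suc n} c (λ i → f (toℕ i) * g (n ∸ toℕ i))))

  -- A path ending at height k + 1 splits at its last visit to height 0.
  last-visit : ∀ b l n k → path b l (suc n) (suc k) ≈ (moments b l ⊛ (λ i → path (tail b) (tail l) i k)) n
  last-visit b l zero zero    =
    solve 2 (λ x y → con 1 :+ x :* con 0 :+ y :* con 0 := con 1 :* con 1 :+ con 0) refl _ _
  last-visit b l zero (suc k) =
    solve 2 (λ x y → con 0 :+ x :* con 0 :+ y :* con 0 := con 1 :* con 0 :+ con 0) refl _ _
  last-visit b l (suc n) zero = sym (begin
    (μ ⊛ T 0) (suc n)
      ≈⟨ ⊛-last μ (T 0) n ⟩
    (μ ⊛ (λ i → b 1 * T 0 i + l 2 * T 1 i)) n + μ (suc n) * 1#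
      ≈⟨ +-cong (coeff≈ (𝕊.distribˡ μ (λ i → b 1 * T 0 i) (λ i → l 2 * T 1 i)) n) (*-identityʳ _) ⟩
    (μ ⊛ (λ i → b 1 * T 0 i)) n + (μ ⊛ (λ i → l 2 * T 1 i)) n + μ (suc n)
      ≈⟨ +-congʳ (+-cong (⊛-scaleʳ μ (b 1) (T 0) n) (⊛-scaleʳ μ (l 2) (T 1) n)) ⟩
    b 1 * (μ ⊛ T 0) n + l 2 * (μ ⊛ T 1) n + μ (suc n)
      ≈⟨ +-congʳ (+-cong (*-congˡ (sym (last-visit b l n 0))) (*-congˡ (sym (last-visit b l n 1)))) ⟩
    b 1 * path b l (suc n) 1 + l 2 * path b l (suc n) 2 + μ (suc n)
      ≈⟨ solve 3 (λ x y z → x :+ y :+ z := z :+ x :+ y) refl _ _ _ ⟩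
    μ (suc n) + b 1 * path b l (suc n) 1 + l 2 * path b l (suc n) 2 ∎)
    where
    μ = moments b l
    T : ℕ → Series
    T k i = path (tail b) (tail l) i k
  last-visit b l (suc n) (suc k) = sym (begin
    (μ ⊛ T (suc k)) (suc n)
      ≈⟨ ⊛-last μ (T (suc k)) n ⟩
    (μ ⊛ (λ i → T k i + B * T (suc k) i + L * T (suc (suc k)) i)) n + μ (suc n) * 0#
      ≈⟨ trans (+-congˡ (zeroʳ _)) (+-identityʳ _) ⟩
    (μ ⊛ (λ i → T k i + B * T (suc k) i + L * T (suc (suc k)) i)) n
      ≈⟨ coeff≈ (𝕊.distribˡ μ (λ i → T k i + B * T (suc k) i) (λ i → L * T (suc (suc k)) i)) n ⟩
    (μ ⊛ (λ i → T k i + B * T (suc k) i)) n + (μ ⊛ (λ i → L * T (suc (suc k)) i)) n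
      ≈⟨ +-congʳ (coeff≈ (𝕊.distribˡ μ (T k) (λ i → B * T (suc k) i)) n) ⟩
    (μ ⊛ T k) n + (μ ⊛ (λ i → B * T (suc k) i)) n + (μ ⊛ (λ i → L * T (suc (suc k)) i)) n
      ≈⟨ +-cong (+-cong (sym (last-visit b l n k))
                  (trans (⊛-scaleʳ μ B (T (suc k)) n) (*-congˡ (sym (last-visit b l n (suc k))))))
                (trans (⊛-scaleʳ μ L (T (suc (suc k))) n) (*-congˡ (sym (last-visit b l n (suc (suc k)))))) ⟩
    path b l (suc (suc n)) (suc (suc k)) ∎)
    where
    μ = moments b l
    B = b (suc (suc k))
    L = l (suc (suc (suc k)))
    T : ℕ → Series
    T k i = path (tail b) (tail l) i k

  -- The factor `z` is the last step up from height 0: before it comes a path that returns to 0,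
  -- after it one that never goes below height 1.
  path-one : ∀ b l n → path b l n 1 ≈ (z ⊛ (moments (tail b) (tail l) ⊛ moments b l)) n
  path-one b l zero    = sym (z⊛-zero (moments (tail b) (tail l) ⊛ moments b l))
  path-one b l (suc n) = begin
    path b l (suc n) 1                                      ≈⟨ last-visit b l n 0 ⟩
    (moments b l ⊛ moments (tail b) (tail l)) n             ≈⟨ coeff≈ (𝕊.*-comm (moments b l) (moments (tail b) (tail l))) n ⟩
    (moments (tail b) (tail l) ⊛ moments b l) n             ≈⟨ z⊛-suc (moments (tail b) (tail l) ⊛ moments b l) n ⟨
    (z ⊛ (moments (tail b) (tail l) ⊛ moments b l)) (suc n) ∎

  module _ (b l : ℕ → Carrier) (d : ℕ) where

    private
      J′ = jFraction (tail b) (tail l) d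
      J  = jFraction b l (suc d)

      unfolded : J ≋ 𝕊.1# 𝕊.+ (constₛ (b 0) ⊛ (z ⊛ J) 𝕊.+ constₛ (l 1) ⊛ (z ⊛ (z ⊛ (J′ ⊛ J))))
      unfolded = 𝕊.trans
        (Reciprocal.unfold seriesRing (constₛ (b 0) ⊛ z) (constₛ (l 1) ⊛ z ^ 2 ⊛ J′) J (jFraction-equation b l d))
        (𝕊.+-congˡ {𝕊.1#} (𝕊.+-cong (𝕊.*-assoc (constₛ (b 0)) z J)
          (𝕊.trans (𝕊.*-assoc (constₛ (l 1) ⊛ z ^ 2) J′ J)
          (𝕊.trans (𝕊.*-assoc (constₛ (l 1)) (z ^ 2) (J′ ⊛ J))
            (𝕊.*-congˡ {constₛ (l 1)} (𝕊.trans (𝕊.*-congʳ {J′ ⊛ J} (𝕊.*-congˡ {z} (𝕊.*-identityʳ z)))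
                                               (𝕊.*-assoc z z (J′ ⊛ J))))))))

    jFraction-zero : J 0 ≈ 1#
    jFraction-zero = begin
      J 0                                ≈⟨ coeff≈ unfolded 0 ⟩
      1# + ((constₛ (b 0) ⊛ (z ⊛ J)) 0 + (constₛ (l 1) ⊛ (z ⊛ (z ⊛ (J′ ⊛ J)))) 0)
        ≈⟨ +-congˡ (+-cong (trans (constₛ-⊛ (b 0) (z ⊛ J) 0) (*-congˡ (z⊛-zero J)))
                           (trans (constₛ-⊛ (l 1) (z ⊛ (z ⊛ (J′ ⊛ J))) 0) (*-congˡ (z⊛-zero (z ⊛ (J′ ⊛ J)))))) ⟩
      1# + (b 0 * 0# + l 1 * 0#)
        ≈⟨ solve 2 (λ x y → con 1 :+ (x :* con 0 :+ y :* con 0) := con 1) refl _ _ ⟩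
      1# ∎

    jFraction-suc : ∀ n → J (suc n) ≈ b 0 * J n + l 1 * (z ⊛ (J′ ⊛ J)) n
    jFraction-suc n = begin
      J (suc n)                                ≈⟨ coeff≈ unfolded (suc n) ⟩
      0# + ((constₛ (b 0) ⊛ (z ⊛ J)) (suc n) + (constₛ (l 1) ⊛ (z ⊛ (z ⊛ (J′ ⊛ J)))) (suc n))
        ≈⟨ trans (+-identityˡ _) (+-cong
             (trans (constₛ-⊛ (b 0) (z ⊛ J) (suc n)) (*-congˡ (z⊛-suc J n)))
             (trans (constₛ-⊛ (l 1) (z ⊛ (z ⊛ (J′ ⊛ J))) (suc n)) (*-congˡ (z⊛-suc (z ⊛ (J′ ⊛ J)) n)))) ⟩
      b 0 * J n + l 1 * (z ⊛ (J′ ⊛ J)) n ∎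

  -- The truncation after level d corresponds to paths of height at most d, and a path of length n ≤
  -- d cannot rise higher.
  jFraction-moments : ∀ d b l n → n ≤ d → jFraction b l d n ≈ moments b l n
  jFraction-moments zero    b l zero    z≤n = begin
    1# + 0# ≈⟨ +-identityʳ 1# ⟩
    1#      ∎
  jFraction-moments (suc d) b l n n≤1+d = upTo n n≤1+d n ℕₚ.≤-refl
    where
    J′ = jFraction (tail b) (tail l) d
    J  = jFraction b l (suc d)
    μ′ = moments (tail b) (tail l)
    μ  = moments b l
    -- All coefficients up to n are treated at once, because the product of J′ and J reads every
    -- earlier coefficient of J.
    upTo : ∀ n → n ≤ suc d → ∀ i → i ≤ n → J i ≈ μ i
    upTo zero    _         zero z≤n = jFraction-zero b l d
    upTo (suc n) (s≤s n≤d) i i≤1+n with ℕₚ.m≤n⇒m<n∨m≡n i≤1+n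
    ... | inj₁ (s≤s i≤n) = upTo n (ℕₚ.m≤n⇒m≤1+n n≤d) i i≤n
    ... | inj₂ ≡.refl    = begin
      J (suc n)                                ≈⟨ jFraction-suc b l d n ⟩
      b 0 * J n + l 1 * (z ⊛ (J′ ⊛ J)) n
        -- The factor `z` brings the index below n ≤ d, where J′, one level shorter than J, already
        -- agrees with μ′.
        ≈⟨ +-cong (*-congˡ (below n ℕₚ.≤-refl)) (*-congˡ (z⊛-cong (J′ ⊛ J) (μ′ ⊛ μ) n λ i i<n →
             ⊛-cong-upTo {J′} {μ′} {J} {μ} i
               (λ j j≤i → jFraction-moments d (tail b) (tail l) j (ℕₚ.≤-trans j≤i (ℕₚ.≤-trans (ℕₚ.<⇒≤ i<n) n≤d)))
               (λ j j≤i → below j (ℕₚ.≤-trans j≤i (ℕₚ.<⇒≤ i<n))))) ⟩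
      b 0 * μ n + l 1 * (z ⊛ (μ′ ⊛ μ)) n       ≈⟨ +-congˡ (*-congˡ (path-one b l n)) ⟨
      b 0 * μ n + l 1 * path b l n 1           ∎
      where
      below : ∀ i → i ≤ n → J i ≈ μ i
      below = upTo n (ℕₚ.m≤n⇒m≤1+n n≤d)

  jFraction⟶moments : ∀ b l (s : Series) → (∀ n → s n ≈ path b l n 0) → jFraction b l ⟶ s
  jFraction⟶moments b l s s≈ N = N , λ k N≤k n n<N →
    trans (jFraction-moments k b l n (ℕₚ.≤-trans (ℕₚ.<⇒≤ n<N) N≤k)) (sym (s≈ n))

-- Finite sums and natural multiples.

module FiniteSums {a ℓ : Level} (A : CommutativeRing a ℓ) where

  open CommutativeRing A hiding (zero)
  open Sum semiring

  sumTo : ℕ → (ℕ → Carrier) → Carrier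
  sumTo n f = ∑[ i < n ] f (toℕ i)

  sumTo-cong : ∀ n f g → (∀ i → f i ≈ g i) → sumTo n f ≈ sumTo n g
  sumTo-cong n f g p = sum-cong-≋ {n} {λ i → f (toℕ i)} {λ i → g (toℕ i)} (λ i → p (toℕ i))

  sumTo-+ : ∀ n f g → sumTo n (λ i → f i + g i) ≈ sumTo n f + sumTo n g
  sumTo-+ n f g = ∑-distrib-+ {n} (λ i → f (toℕ i)) (λ i → g (toℕ i))

  sumTo-* : ∀ n s f → s * sumTo n f ≈ sumTo n (λ i → s * f i)
  sumTo-* n s f = *-distribˡ-sum {n} s (λ i → f (toℕ i))

  sumTo-extend : ∀ {n N} f → n ≤ N → (∀ i → n ≤ i → f i ≈ 0#) → sumTo n f ≈ sumTo N f
  sumTo-extend {N = N} f z≤n p = sym (trans (sumTo-cong N f (λ _ → 0#) (λ i → p i z≤n)) (sum-replicate-zero N))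
  sumTo-extend f (s≤s n≤N) p = +-congˡ (sumTo-extend (λ i → f (suc i)) n≤N (λ i n≤i → p (suc i) (s≤s n≤i)))

module NaturalScalars {a ℓ : Level} (A : CommutativeRing a ℓ) where

  open CommutativeRing A
  open Mult semiring public renaming (_×_ to _·_)
  open NaturalCoefficients commutativeSemiring using (solve; _:=_; _:+_; _:*_; con)

  ι : ℕ → Carrier
  ι n = n · 1#

  ·≈ι* : ∀ n x → n · x ≈ ι n * x
  ·≈ι* n x = sym (trans (×-assoc-* n 1# x) (×-congʳ n (*-identityˡ x)))

  ι-odd : ∀ n → ι (2 ℕ.* n ℕ.+ 1) ≈ ι n + ι n + 1#
  ι-odd n = trans (×-homo-+ 1# (2 ℕ.* n) 1) (trans (+-congʳ (×-homo-+ 1# n (n ℕ.+ 0)))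
    (trans (+-congʳ (+-congˡ (×-homo-+ 1# n 0)))
      (solve 1 (λ x → x :+ (x :+ con 0) :+ (con 1 :+ con 0) := x :+ x :+ con 1) refl (ι n))))

  ι-square : ∀ n → ι (n ℕ.^ 2) ≈ ι n * ι n
  ι-square n = trans (×1-homo-* n (n ℕ.* 1)) (*-congˡ (×-congˡ (ℕₚ.*-identityʳ n)))

-- The triangular recurrence of the Whitney numbers.

module WhitneyNumbers {c ℓ : Level} (R : CommutativeRing c ℓ) (m : CommutativeRing.Carrier R) where

  open CommutativeRing R hiding (zero)
  open TannyDowling R m using (W)
  open FiniteSums R
  open NaturalScalars R
  open NaturalCoefficients commutativeSemiring using (solve; _:=_; _:+_; _:*_; con)
  open Exp semiring using (_^_)
  open import Relation.Binary.Reasoning.Setoid setoid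

  coefficient : ℕ → ℕ → ℕ → ℕ
  coefficient n k i = (n C i) ℕ.* stirling₂ i k

  term : ℕ → ℕ → ℕ → Carrier
  term n k j = coefficient n k (k ℕ.+ j) · (m ^ j)

  stirling₂-high : ∀ n k → n < k → stirling₂ n k ≡ 0
  stirling₂-high zero    (suc k) _ = ≡.refl
  stirling₂-high (suc n) (suc k) (s≤s n<k)
    rewrite stirling₂-high n k n<k | stirling₂-high n (suc k) (ℕₚ.m≤n⇒m≤1+n n<k) | ℕₚ.*-zeroʳ k = ≡.refl

  -- Pascal's rule splits the binomial. The Stirling recurrence is then wanted only beside `n C i`,
  -- since the part with `n C suc i` is again a `coefficient`.
  coefficient-suc : ∀ n k i → coefficient (suc n) (suc k) (suc i) ≡
    coefficient n k i ℕ.+ coefficient n (suc k) (suc i) ℕ.+ suc k ℕ.* coefficient n (suc k) i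
  coefficient-suc n k i rewrite ≡.sym (nCk+nC[k+1]≡[n+1]C[k+1] n i) =
    ℕS.solve 5 (λ p q k s t →
      (p ℕS.:+ q) ℕS.:* (k ℕS.:* s ℕS.:+ t) ℕS.:=
      p ℕS.:* t ℕS.:+ q ℕS.:* (k ℕS.:* s ℕS.:+ t) ℕS.:+ k ℕS.:* (p ℕS.:* s)) ≡.refl
      (n C i) (n C suc i) (suc k) (stirling₂ i (suc k)) (stirling₂ i k)
    where module ℕS = ℕSolver.+-*-Solver

  coefficient-high : ∀ n k i → n < i → coefficient n k i ≡ 0
  coefficient-high n k i n<i = ≡.cong (ℕ._* stirling₂ i k) (k>n⇒nCk≡0 n<i)

  -- The terms beyond the range of `W` carry a vanishing binomial. A common length `N` lets the
  -- recurrence compare sums for different n and k.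
  W≈sumTo : ∀ n k N → suc n ∸ k ≤ N → W n k ≈ sumTo N (term n k)
  W≈sumTo n k N n-k≤N = sumTo-extend (term n k) n-k≤N λ j n-k≤j →
    ×-congˡ (coefficient-high n k (k ℕ.+ j) (ℕₚ.≤-trans (ℕₚ.m≤n+m∸n (suc n) k) (ℕₚ.+-monoʳ-≤ k n-k≤j)))

  W-high : ∀ n k → n < k → W n k ≈ 0#
  W-high n k n<k = W≈sumTo n k 0 (ℕₚ.≤-reflexive (ℕₚ.m≤n⇒m∸n≡0 n<k))

  W-zero : ∀ n → W n 0 ≈ 1#
  W-zero n = begin
    term n 0 0 + sumTo n (λ j → term n 0 (suc j))
      ≈⟨ +-cong (×-homo-1 1#) (sym (sumTo-extend {0} {n} (λ j → term n 0 (suc j)) z≤n λ j _ →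
           ×-congˡ (ℕₚ.*-zeroʳ (n C suc j)))) ⟩
    1# + 0#  ≈⟨ +-identityʳ 1# ⟩
    1#       ∎

  -- The boundary case of `term-suc`: its third summand would carry the exponent j - 1, but here the
  -- Stirling number S(k, k + 1) is zero.
  term-zero : ∀ n k → term (suc n) (suc k) 0 ≈ term n k 0 + term n (suc k) 0
  term-zero n k = trans (×-congˡ (≡.trans (coefficient-suc n k (k ℕ.+ 0)) (≡.trans
      (≡.cong (λ s → coefficient n k (k ℕ.+ 0) ℕ.+ coefficient n (suc k) (suc k ℕ.+ 0) ℕ.+ suc k ℕ.* ((n C (k ℕ.+ 0)) ℕ.* s))
        (stirling₂-high (k ℕ.+ 0) (suc k) (s≤s (ℕₚ.≤-reflexive (ℕₚ.+-identityʳ k)))))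
      (≡.trans (≡.cong (λ s → coefficient n k (k ℕ.+ 0) ℕ.+ coefficient n (suc k) (suc k ℕ.+ 0) ℕ.+ suc k ℕ.* s)
                 (ℕₚ.*-zeroʳ (n C (k ℕ.+ 0))))
      (≡.trans (≡.cong (coefficient n k (k ℕ.+ 0) ℕ.+ coefficient n (suc k) (suc k ℕ.+ 0) ℕ.+_) (ℕₚ.*-zeroʳ k))
               (ℕₚ.+-identityʳ _))))))
    (×-homo-+ 1# (coefficient n k (k ℕ.+ 0)) (coefficient n (suc k) (suc k ℕ.+ 0)))

  term-suc : ∀ n k j → term (suc n) (suc k) (suc j) ≈
    term n k (suc j) + term n (suc k) (suc j) + ι (suc k) * m * term n (suc k) j
  term-suc n k j = begin
    term (suc n) (suc k) (suc j)
      ≈⟨ ×-congˡ (coefficient-suc n k (k ℕ.+ suc j)) ⟩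
    (p ℕ.+ q ℕ.+ suc k ℕ.* coefficient n (suc k) (k ℕ.+ suc j)) · (m * m ^ j)
      ≡⟨ ≡.cong (λ i → (p ℕ.+ q ℕ.+ suc k ℕ.* coefficient n (suc k) i) · (m * m ^ j)) (ℕₚ.+-suc k j) ⟩
    (p ℕ.+ q ℕ.+ suc k ℕ.* r) · (m * m ^ j)
      ≈⟨ trans (×-homo-+ _ (p ℕ.+ q) (suc k ℕ.* r)) (+-cong (×-homo-+ _ p q)
           (trans (·≈ι* (suc k ℕ.* r) _) (*-congʳ (×1-homo-* (suc k) r)))) ⟩
    term n k (suc j) + term n (suc k) (suc j) + ι (suc k) * ι r * (m * m ^ j)
      ≈⟨ +-congˡ (solve 4 (λ k r m y → (k :* r) :* (m :* y) := k :* m :* (r :* y)) refl (ι (suc k)) (ι r) m (m ^ j)) ⟩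
    term n k (suc j) + term n (suc k) (suc j) + ι (suc k) * m * (ι r * m ^ j)
      ≈⟨ +-congˡ (*-congˡ (·≈ι* r (m ^ j))) ⟨
    term n k (suc j) + term n (suc k) (suc j) + ι (suc k) * m * term n (suc k) j ∎
    where
    p = coefficient n k (k ℕ.+ suc j)
    q = coefficient n (suc k) (suc k ℕ.+ suc j)
    r = coefficient n (suc k) (suc k ℕ.+ j)

  W-suc : ∀ n k → W (suc n) (suc k) ≈ W n k + (1# + ι (suc k) * m) * W n (suc k)
  W-suc n k = begin
    W (suc n) (suc k)
      ≈⟨ W≈sumTo (suc n) (suc k) (suc N) (ℕₚ.m≤n⇒m≤1+n (ℕₚ.m∸n≤m N k)) ⟩
    term (suc n) (suc k) 0 + sumTo N (λ j → term (suc n) (suc k) (suc j))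
      ≈⟨ +-cong (term-zero n k) (trans (sumTo-cong N _ (λ j → u (suc j) + v (suc j) + ι (suc k) * m * v j) (term-suc n k))
          (trans (sumTo-+ N (λ j → u (suc j) + v (suc j)) (λ j → ι (suc k) * m * v j))
            (+-cong (sumTo-+ N (λ j → u (suc j)) (λ j → v (suc j))) (sym (sumTo-* N (ι (suc k) * m) v))))) ⟩
    (u 0 + v 0) + (sumTo N (λ j → u (suc j)) + sumTo N (λ j → v (suc j)) + ι (suc k) * m * sumTo N v)
      -- The first two sums recover their terms at j = 0; the third comes with its index lowered by
      -- one and keeps length `N`.
      ≈⟨ solve 6 (λ p q r s x y → (p :+ q) :+ (r :+ s :+ x :* y) := (p :+ r) :+ ((q :+ s) :+ x :* y)) refl _ _ _ _ _ _ ⟩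
    sumTo (suc N) u + (sumTo (suc N) v + ι (suc k) * m * sumTo N v)
      ≈⟨ +-cong (W≈sumTo n k (suc N) (ℕₚ.m≤n⇒m≤1+n (ℕₚ.m∸n≤m N k)))
          (+-cong (W≈sumTo n (suc k) (suc N) (ℕₚ.m≤n⇒m≤1+n (ℕₚ.m∸n≤m N (suc k))))
                  (*-congˡ (W≈sumTo n (suc k) N (ℕₚ.m∸n≤m N (suc k))))) ⟨
    W n k + (W n (suc k) + ι (suc k) * m * W n (suc k))
      ≈⟨ solve 3 (λ w x y → w :+ (y :+ x :* y) := w :+ (con 1 :+ x) :* y) refl _ _ _ ⟩
    W n k + (1# + ι (suc k) * m) * W n (suc k) ∎
    where
    N = suc n
    u = term n k
    v = term n (suc k)

-- The operator T and its tridiagonal form.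

module WhitneyTransform {a ℓ : Level} (A : CommutativeRing a ℓ) (x M : CommutativeRing.Carrier A) where

  open CommutativeRing A hiding (zero)
  open FiniteSums A
  open NaturalScalars A
  open NaturalCoefficients commutativeSemiring using (solve; _:=_; _:+_; _:*_; con)
  open Exp semiring using (_^_)
  open LinearMaps A
  open StieltjesTable A using (path)
  open import Relation.Binary.Reasoning.Setoid setoid

  -- The first two are the weights of the coordinate shift in the vectors `basis k`; the other two
  -- are those of T, the b and l of the theorem.
  levelWeight downWeight₀ levelWeightₘ downWeightₘ : ℕ → Carrier
  levelWeight k = (ι k + ι k + 1#) * x
  downWeight₀ k = ι k * ι k * (x * x)
  levelWeightₘ k = levelWeight k + ι k * M + 1#
  downWeightₘ k = ι k * ι k * (x * (x + M))

  levelWeightₘ-· : ∀ k → (2 ℕ.* k ℕ.+ 1) · x + k · M + 1# ≈ levelWeightₘ k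
  levelWeightₘ-· k = +-congʳ (+-cong (trans (·≈ι* (2 ℕ.* k ℕ.+ 1) x) (*-congʳ (ι-odd k))) (·≈ι* k M))

  downWeightₘ-· : ∀ k → (k ℕ.^ 2) · (x * (x + M)) ≈ downWeightₘ k
  downWeightₘ-· k = trans (·≈ι* (k ℕ.^ 2) _) (*-congʳ (ι-square k))

  -- basis k j = (j! / k!) (j choose k) x^(j - k).
  basis : ℕ → Column
  basis k j = path levelWeight downWeight₀ j k

  -- (j - k) basis k j = (k + 1)² x basis (k + 1) j, with k moved to the right to avoid subtraction.
  basis-weight : ∀ j k → ι j * basis k j ≈ ι k * basis k j + ι (suc k) * ι (suc k) * (x * basis (suc k) j)
  basis-weight zero    zero    = solve 2 (λ x o → con 0 :* con 1 := con 0 :* con 1 :+ o :* o :* (x :* con 0)) refl x _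
  basis-weight zero    (suc k) = solve 3 (λ x i o → con 0 :* con 0 := i :* con 0 :+ o :* o :* (x :* con 0)) refl x _ _
  basis-weight (suc j) zero    = begin
    ι (suc j) * basis 0 (suc j)
      ≈⟨ solve 4 (λ x J s t →
           let L₁ = (con 1 :+ con 0) :* (con 1 :+ con 0) :* (x :* x) ; B₀ = (con 0 :+ con 0 :+ con 1) :* x
           in (con 1 :+ J) :* (B₀ :* s :+ L₁ :* t) :=
              B₀ :* s :+ L₁ :* t :+ x :* (J :* s) :+ x :* x :* (J :* t)) refl x (ι j) (basis 0 j) (basis 1 j) ⟩
    basis 0 (suc j) + x * (ι j * basis 0 j) + x * x * (ι j * basis 1 j)
      ≈⟨ +-cong (+-congˡ (*-congˡ (basis-weight j 0))) (*-congˡ (basis-weight j 1)) ⟩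
    basis 0 (suc j) + x * (ι 0 * basis 0 j + ι 1 * ι 1 * (x * basis 1 j))
      + x * x * (ι 1 * basis 1 j + ι 2 * ι 2 * (x * basis 2 j))
      ≈⟨ solve 4 (λ x s t u →
           let i₁ = con 1 :+ con 0 ; i₂ = con 1 :+ i₁
               L₁ = i₁ :* i₁ :* (x :* x) ; L₂ = i₂ :* i₂ :* (x :* x)
               B₀ = (con 0 :+ con 0 :+ con 1) :* x ; B₁ = (i₁ :+ i₁ :+ con 1) :* x
           in (B₀ :* s :+ L₁ :* t) :+ x :* (con 0 :* s :+ i₁ :* i₁ :* (x :* t))
                :+ x :* x :* (i₁ :* t :+ i₂ :* i₂ :* (x :* u)) :=
              con 0 :* (B₀ :* s :+ L₁ :* t) :+ i₁ :* i₁ :* (x :* (s :+ B₁ :* t :+ L₂ :* u)))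
           refl x (basis 0 j) (basis 1 j) (basis 2 j) ⟩
    ι 0 * basis 0 (suc j) + ι 1 * ι 1 * (x * basis 1 (suc j)) ∎
  basis-weight (suc j) (suc k) = begin
    ι (suc j) * basis (suc k) (suc j)
      ≈⟨ solve 6 (λ J B L r s t → (con 1 :+ J) :* (r :+ B :* s :+ L :* t) :=
           (r :+ B :* s :+ L :* t) :+ (J :* r :+ B :* (J :* s) :+ L :* (J :* t)))
           refl (ι j) (levelWeight (suc k)) (downWeight₀ (suc (suc k))) _ _ _ ⟩
    basis (suc k) (suc j) + (ι j * basis k j + levelWeight (suc k) * (ι j * basis (suc k) j)
      + downWeight₀ (suc (suc k)) * (ι j * basis (suc (suc k)) j))
      ≈⟨ +-congˡ (+-cong (+-cong (basis-weight j k) (*-congˡ (basis-weight j (suc k))))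
                         (*-congˡ (basis-weight j (suc (suc k))))) ⟩
    basis (suc k) (suc j) + ((ι k * basis k j + ι (suc k) * ι (suc k) * (x * basis (suc k) j))
      + levelWeight (suc k) * (ι (suc k) * basis (suc k) j + ι (suc (suc k)) * ι (suc (suc k)) * (x * basis (suc (suc k)) j))
      + downWeight₀ (suc (suc k)) * (ι (suc (suc k)) * basis (suc (suc k)) j
          + ι (suc (suc (suc k))) * ι (suc (suc (suc k))) * (x * basis (suc (suc (suc k))) j)))
      -- Every `ι j` is gone: both sides are linear in the entries of row j at heights k, ..., k +
      -- 3, with coefficients polynomial in `x` and `ι k`.
      ≈⟨ solve 6 (λ x k₀ r s t u →
           let k₁ = con 1 :+ k₀ ; k₂ = con 1 :+ k₁ ; k₃ = con 1 :+ k₂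
               B₁ = (k₁ :+ k₁ :+ con 1) :* x ; B₂ = (k₂ :+ k₂ :+ con 1) :* x
               L₂ = k₂ :* k₂ :* (x :* x) ; L₃ = k₃ :* k₃ :* (x :* x)
           in (r :+ B₁ :* s :+ L₂ :* t)
                :+ ((k₀ :* r :+ k₁ :* k₁ :* (x :* s)) :+ B₁ :* (k₁ :* s :+ k₂ :* k₂ :* (x :* t))
                    :+ L₂ :* (k₂ :* t :+ k₃ :* k₃ :* (x :* u))) :=
              k₁ :* (r :+ B₁ :* s :+ L₂ :* t) :+ k₂ :* k₂ :* (x :* (s :+ B₂ :* t :+ L₃ :* u)))
           refl x (ι k) _ _ _ _ ⟩
    ι (suc k) * basis (suc k) (suc j)
      + ι (suc (suc k)) * ι (suc (suc k)) * (x * basis (suc (suc k)) (suc j)) ∎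

  -- By `basis-weight` at k = 0, x times `basis 1 j` is j times `basis 0 j`, so the path recurrence
  -- collapses to multiplication by (j + 1) x.
  basis-zero : ∀ j → basis 0 j ≈ ι (j !) * x ^ j
  basis-zero zero    = solve 0 (con 1 := (con 1 :+ con 0) :* con 1) refl
  basis-zero (suc j) = begin
    basis 0 (suc j)
      ≈⟨ solve 3 (λ x s t → let i₁ = con 1 :+ con 0 in
           (con 0 :+ con 0 :+ con 1) :* x :* s :+ i₁ :* i₁ :* (x :* x) :* t :=
           x :* s :+ x :* (con 0 :* s :+ i₁ :* i₁ :* (x :* t))) refl x _ _ ⟩
    x * basis 0 j + x * (ι 0 * basis 0 j + ι 1 * ι 1 * (x * basis 1 j))
      ≈⟨ +-congˡ (*-congˡ (basis-weight j 0)) ⟨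
    x * basis 0 j + x * (ι j * basis 0 j)
      ≈⟨ +-cong (*-congˡ (basis-zero j)) (*-congˡ (*-congˡ (basis-zero j))) ⟩
    x * (ι (j !) * x ^ j) + x * (ι j * (ι (j !) * x ^ j))
      ≈⟨ solve 4 (λ x J F y → x :* (F :* y) :+ x :* (J :* (F :* y)) := ((con 1 :+ J) :* F) :* (x :* y))
           refl x (ι j) (ι (j !)) (x ^ j) ⟩
    ι (suc j) * ι (j !) * (x * x ^ j)
      ≈⟨ *-congʳ (×1-homo-* (suc j) (j !)) ⟨
    ι (suc j !) * (x * x ^ j) ∎

  raise : Column → Column
  raise v j = (1# + ι j * M) * v j + v (suc j)

  -- The entry at `suc j` expands by the recurrence of `path`, and `basis-weight` trades the factor
  -- `ι j` for `basis 1`. No j is left in the coefficients, so this is a relation between vectors,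
  -- to which `evaluate n` applies.
  raise-basis-zero : ∀ j → raise (basis 0) j ≈ levelWeightₘ 0 * basis 0 j + downWeightₘ 1 * basis 1 j
  raise-basis-zero j = begin
    (1# + ι j * M) * basis 0 j + basis 0 (suc j)
      ≈⟨ solve 4 (λ M J s c → (con 1 :+ J :* M) :* s :+ c := s :+ M :* (J :* s) :+ c) refl M (ι j) _ _ ⟩
    basis 0 j + M * (ι j * basis 0 j) + basis 0 (suc j)
      ≈⟨ +-congʳ (+-congˡ (*-congˡ (basis-weight j 0))) ⟩
    basis 0 j + M * (ι 0 * basis 0 j + ι 1 * ι 1 * (x * basis 1 j)) + basis 0 (suc j)
      ≈⟨ solve 4 (λ x M s t → let i₁ = con 1 :+ con 0 ; B₀ = (con 0 :+ con 0 :+ con 1) :* x in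
           s :+ M :* (con 0 :* s :+ i₁ :* i₁ :* (x :* t)) :+ (B₀ :* s :+ i₁ :* i₁ :* (x :* x) :* t) :=
           (B₀ :+ con 0 :* M :+ con 1) :* s :+ i₁ :* i₁ :* (x :* (x :+ M)) :* t) refl x M _ _ ⟩
    levelWeightₘ 0 * basis 0 j + downWeightₘ 1 * basis 1 j ∎

  raise-basis-suc : ∀ k j → raise (basis (suc k)) j ≈
    basis k j + levelWeightₘ (suc k) * basis (suc k) j + downWeightₘ (suc (suc k)) * basis (suc (suc k)) j
  raise-basis-suc k j = begin
    (1# + ι j * M) * basis (suc k) j + basis (suc k) (suc j)
      ≈⟨ solve 4 (λ M J s c → (con 1 :+ J :* M) :* s :+ c := s :+ M :* (J :* s) :+ c) refl M (ι j) _ _ ⟩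
    basis (suc k) j + M * (ι j * basis (suc k) j) + basis (suc k) (suc j)
      ≈⟨ +-congʳ (+-congˡ (*-congˡ (basis-weight j (suc k)))) ⟩
    basis (suc k) j + M * (ι (suc k) * basis (suc k) j + ι (suc (suc k)) * ι (suc (suc k)) * (x * basis (suc (suc k)) j))
      + basis (suc k) (suc j)
      ≈⟨ solve 7 (λ x M k₁ k₂ r s t → let B = (k₁ :+ k₁ :+ con 1) :* x in
           s :+ M :* (k₁ :* s :+ k₂ :* k₂ :* (x :* t)) :+ (r :+ B :* s :+ k₂ :* k₂ :* (x :* x) :* t) :=
           r :+ (B :+ k₁ :* M :+ con 1) :* s :+ k₂ :* k₂ :* (x :* (x :+ M)) :* t)
           refl x M (ι (suc k)) (ι (suc (suc k))) _ _ _ ⟩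
    basis k j + levelWeightₘ (suc k) * basis (suc k) j + downWeightₘ (suc (suc k)) * basis (suc (suc k)) j ∎

  -- The number (Tⁿ v)₀, with one T taken off next to v, so that inductions on n change the vector.
  evaluate : ℕ → Column → Carrier
  evaluate zero    v = v 0
  evaluate (suc n) v = evaluate n (raise v)

  Linear-evaluate : ∀ n → Linear (evaluate n)
  Linear-evaluate zero = record
    { cong = λ p → p 0 ; add = λ u v → refl ; scale = λ s u → refl }
  Linear-evaluate (suc n) = record
    { cong  = λ p → cong lin (λ i → +-cong (*-congˡ (p i)) (p (suc i)))
    ; add   = λ u v → trans
        (cong lin (λ i → solve 5 (λ y p q r s → y :* (p :+ q) :+ (r :+ s) := (y :* p :+ r) :+ (y :* q :+ s)) refl _ _ _ _ _))
        (add lin (raise u) (raise v))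
    ; scale = λ s u → trans
        (cong lin (λ i → solve 4 (λ y s p q → y :* (s :* p) :+ s :* q := s :* (y :* p :+ q)) refl _ _ _ _))
        (scale lin s (raise u))
    }
    where lin = Linear-evaluate n

  -- The action of T on the vectors is the recurrence of `path` in its height, and at index 0 only
  -- `basis 0` has a nonzero entry.
  evaluate-basis : ∀ n k → evaluate n (basis k) ≈ path levelWeightₘ downWeightₘ n k
  evaluate-basis zero    zero    = refl
  evaluate-basis zero    (suc k) = refl
  evaluate-basis (suc n) zero    = begin
    evaluate n (raise (basis 0))
      ≈⟨ cong lin raise-basis-zero ⟩
    evaluate n (λ j → levelWeightₘ 0 * basis 0 j + downWeightₘ 1 * basis 1 j)
      ≈⟨ trans (add lin _ _) (+-cong (scale lin _ _) (scale lin _ _)) ⟩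
    levelWeightₘ 0 * evaluate n (basis 0) + downWeightₘ 1 * evaluate n (basis 1)
      ≈⟨ +-cong (*-congˡ (evaluate-basis n 0)) (*-congˡ (evaluate-basis n 1)) ⟩
    path levelWeightₘ downWeightₘ (suc n) 0 ∎
    where lin = Linear-evaluate n
  evaluate-basis (suc n) (suc k) = begin
    evaluate n (raise (basis (suc k)))
      ≈⟨ cong lin (raise-basis-suc k) ⟩
    evaluate n (λ j → basis k j + levelWeightₘ (suc k) * basis (suc k) j + downWeightₘ (suc (suc k)) * basis (suc (suc k)) j)
      ≈⟨ trans (add lin _ _) (+-cong (trans (add lin _ _) (+-congˡ (scale lin _ _))) (scale lin _ _)) ⟩
    evaluate n (basis k) + levelWeightₘ (suc k) * evaluate n (basis (suc k))
      + downWeightₘ (suc (suc k)) * evaluate n (basis (suc (suc k)))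
      ≈⟨ +-cong (+-cong (evaluate-basis n k) (*-congˡ (evaluate-basis n (suc k))))
                (*-congˡ (evaluate-basis n (suc (suc k)))) ⟩
    path levelWeightₘ downWeightₘ (suc n) (suc k) ∎
    where lin = Linear-evaluate n

  module _ (w : ℕ → ℕ → Carrier) (w-zero : ∀ n → w n 0 ≈ 1#) (w-high : ∀ n k → n < k → w n k ≈ 0#)
           (w-suc : ∀ n k → w (suc n) (suc k) ≈ w n k + (1# + ι (suc k) * M) * w n (suc k)) where

    -- The recurrence of `w` is the transpose of `raise`: reindexing the sum moves it from `w` onto
    -- v, which is therefore arbitrary in the induction.
    sum-w : ∀ n v → sumTo (suc n) (λ j → w n j * v j) ≈ evaluate n v
    sum-w zero    v = trans (+-identityʳ _) (trans (*-congʳ (w-zero 0)) (*-identityˡ _))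
    sum-w (suc n) v = begin
      w (suc n) 0 * v 0 + sumTo N (λ j → w (suc n) (suc j) * v (suc j))
        ≈⟨ +-cong (*-congʳ (trans (w-zero (suc n)) (sym (w-zero n))))
             (trans (sumTo-cong N _ (λ j → p (suc j) + q j) λ j → trans (*-congʳ (w-suc n j))
                (solve 4 (λ w y u t → (w :+ y :* u) :* t := y :* (u :* t) :+ w :* t) refl _ _ _ _))
               (sumTo-+ N (λ j → p (suc j)) q)) ⟩
      w n 0 * v 0 + (sumTo N (λ j → p (suc j)) + sumTo N q)
        -- Since 1 + 0 · M is 1, column 0 of `w` fits the pattern of the other columns.
        ≈⟨ trans (sym (+-assoc _ _ _)) (+-congʳ (+-congʳ
             (solve 3 (λ w t M → w :* t := (con 1 :+ con 0 :* M) :* (w :* t)) refl (w n 0) (v 0) M))) ⟩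
      sumTo (suc N) p + sumTo N q
        -- The extra summand has index n + 1, where `w n` vanishes; both sums now have length n + 1.
        ≈⟨ +-congʳ (sumTo-extend p (ℕₚ.n≤1+n N) λ j n<j →
             trans (*-congˡ (trans (*-congʳ (w-high n j n<j)) (zeroˡ _))) (zeroʳ _)) ⟨
      sumTo N p + sumTo N q
        ≈⟨ sumTo-+ N p q ⟨
      sumTo N (λ j → p j + q j)
        ≈⟨ sumTo-cong N (λ j → p j + q j) (λ j → w n j * raise v j) (λ j →
             solve 4 (λ y w s t → y :* (w :* s) :+ w :* t := w :* (y :* s :+ t)) refl _ _ _ _) ⟩
      sumTo N (λ j → w n j * raise v j)
        ≈⟨ sum-w n (raise v) ⟩
      evaluate n (raise v) ∎
      where
      N = suc n
      p q : ℕ → Carrier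
      p j = (1# + ι j * M) * (w n j * v j)
      q j = w n j * v (suc j)

    moments-w : ∀ n → sumTo (suc n) (λ j → (j !) · w n j * x ^ j) ≈ path levelWeightₘ downWeightₘ n 0
    moments-w n = begin
      sumTo (suc n) (λ j → (j !) · w n j * x ^ j)
        ≈⟨ sumTo-cong (suc n) (λ j → w n j * basis 0 j) (λ j → (j !) · w n j * x ^ j) (λ j →
             trans (*-congˡ (basis-zero j))
               (trans (solve 3 (λ i w y → w :* (i :* y) := i :* w :* y) refl (ι (j !)) (w n j) (x ^ j))
                 (*-congʳ (sym (·≈ι* (j !) (w n j)))))) ⟨
      sumTo (suc n) (λ j → w n j * basis 0 j)         ≈⟨ sum-w n (basis 0) ⟩
      evaluate n (basis 0)                            ≈⟨ evaluate-basis n 0 ⟩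
      path levelWeightₘ downWeightₘ n 0               ∎

-- The closed form of the product of the down weights.

module HankelProduct {a ℓ : Level} (A : CommutativeRing a ℓ) where

  open CommutativeRing A hiding (zero)
  open NaturalScalars A
  open NaturalCoefficients commutativeSemiring using (solve; _:=_; _:+_; _:*_; con)
  open Exp semiring using (_^_; ^-homo-*; ^-congʳ)
  open StieltjesTable A using (downWeight)
  open ExteriorDeterminant A using (diagonalProduct)
  open import Relation.Binary.Reasoning.Setoid setoid

  private
    Π : ∀ {n} → (Fin n → Carrier) → Carrier
    Π = product (Semiring.rawSemiring semiring)

    Π-cong : ∀ n (f g : Fin n → Carrier) → (∀ i → f i ≈ g i) → Π f ≈ Π g
    Π-cong n f g = CommutativeMonoidSum.sum-cong-≋ *-commutativeMonoid {n} {f} {g}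

  downWeight-square : ∀ q l → (∀ k → l k ≈ ι k * ι k * q) → ∀ k → downWeight l k ≈ q ^ k * ι (k !) ^ 2
  downWeight-square q l l≈ zero    =
    solve 0 (con 1 := con 1 :* ((con 1 :+ con 0) :* ((con 1 :+ con 0) :* con 1))) refl
  downWeight-square q l l≈ (suc k) = begin
    l (suc k) * downWeight l k
      ≈⟨ *-cong (l≈ (suc k)) (downWeight-square q l l≈ k) ⟩
    ι (suc k) * ι (suc k) * q * (q ^ k * ι (k !) ^ 2)
      ≈⟨ solve 4 (λ i q y f → i :* i :* q :* (y :* (f :* (f :* con 1))) :=
           q :* y :* ((i :* f) :* ((i :* f) :* con 1))) refl (ι (suc k)) q (q ^ k) (ι (k !)) ⟩
    q ^ suc k * (ι (suc k) * ι (k !)) ^ 2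
      ≈⟨ *-congˡ (*-cong (×1-homo-* (suc k) (k !)) (*-congʳ (×1-homo-* (suc k) (k !)))) ⟨
    q ^ suc k * ι (suc k !) ^ 2 ∎

  exponent-suc : ∀ r n → r ℕ.+ (suc r ℕ.* n ℕ.+ n C 2) ≡ r ℕ.* suc n ℕ.+ suc n C 2
  exponent-suc r n rewrite ≡.sym (nCk+nC[k+1]≡[n+1]C[k+1] n 1) | nC1≡n n =
    ℕS.solve 3 (λ r n t → r ℕS.:+ ((ℕS.con 1 ℕS.:+ r) ℕS.:* n ℕS.:+ t) ℕS.:=
                          r ℕS.:* (ℕS.con 1 ℕS.:+ n) ℕS.:+ (n ℕS.:+ t)) ≡.refl r n (n C 2)
    where module ℕS = ℕSolver.+-*-Solver

  -- The exponents r, ..., r + n - 1 add up to r n + (n choose 2). The start r is general because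
  -- the recursion raises it.
  diagonalProduct-power : ∀ q (d g : ℕ → Carrier) → (∀ k → d k ≈ q ^ k * g k) → ∀ r n →
    diagonalProduct d r n ≈ q ^ (r ℕ.* n ℕ.+ n C 2) * Π {n} (λ i → g (r ℕ.+ toℕ i))
  diagonalProduct-power q d g d≈ r zero    = sym (trans (*-identityʳ _)
    (^-congʳ q (≡.trans (ℕₚ.+-identityʳ (r ℕ.* 0)) (ℕₚ.*-zeroʳ r))))
  diagonalProduct-power q d g d≈ r (suc n) = begin
    d r * diagonalProduct d (suc r) n
      ≈⟨ *-cong (d≈ r) (diagonalProduct-power q d g d≈ (suc r) n) ⟩
    q ^ r * g r * (q ^ e * Π {n} (λ i → g (suc r ℕ.+ toℕ i)))
      ≈⟨ solve 4 (λ y s t u → y :* s :* (t :* u) := (y :* t) :* (s :* u)) refl _ _ _ _ ⟩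
    q ^ r * q ^ e * (g r * Π {n} (λ i → g (suc r ℕ.+ toℕ i)))
      ≈⟨ *-cong (trans (sym (^-homo-* q r e)) (^-congʳ q (exponent-suc r n)))
           (*-cong (reflexive (≡.cong g (≡.sym (ℕₚ.+-identityʳ r))))
             (Π-cong n _ (λ i → g (r ℕ.+ suc (toℕ i))) (λ i → reflexive (≡.cong g (≡.sym (ℕₚ.+-suc r (toℕ i))))))) ⟩
    q ^ (r ℕ.* suc n ℕ.+ suc n C 2) * Π {suc n} (λ i → g (r ℕ.+ toℕ i)) ∎
    where e = suc r ℕ.* n ℕ.+ n C 2

-- Both conclusions for two elements x and M of any commutative ring.

module _ {a ℓ : Level} (A : CommutativeRing a ℓ) (x M : CommutativeRing.Carrier A) where

  open CommutativeRing A
  open Mult semiring renaming (_×_ to _·_)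
  open Exp semiring using (_^_)
  open PowerSeries A
  open Determinants A
  open StieltjesTable A
  open WhitneyTransform A x M
  open HankelProduct A

  fraction-and-hankel : ∀ (s : ℕ → Carrier) → (∀ n → s n ≈ path levelWeightₘ downWeightₘ n 0) →
    (jFraction (λ n → (2 ℕ.* n ℕ.+ 1) · x + n · M + 1#) (λ n → (n ℕ.^ 2) · (x * (x + M))) ⟶ s)
    ×
    (∀ n → hankel s n ≈
       (x * (x + M)) ^ (suc n C 2)
         * product (Semiring.rawSemiring semiring) {suc n} (λ k → ((toℕ k !) · 1#) ^ 2))
  fraction-and-hankel s s≈ =
      jFraction⟶moments b l s (λ n → trans (s≈ n) (sym (path-cong levelWeightₘ-· downWeightₘ-· n 0)))
    , λ n → trans (hankel-path levelWeightₘ downWeightₘ s s≈ n)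
        (diagonalProduct-power q (downWeight downWeightₘ) (λ k → ((k !) · 1#) ^ 2)
          (downWeight-square q downWeightₘ (λ _ → refl)) 0 (suc n))
    where
    q = x * (x + M)
    b l : ℕ → Carrier
    b n = (2 ℕ.* n ℕ.+ 1) · x + n · M + 1#
    l n = (n ℕ.^ 2) · q

-- Transfer of the Whitney recurrence to constant polynomials.

module TannyDowlingMoments {c ℓ : Level} (R : CommutativeRing c ℓ) (m : CommutativeRing.Carrier R) where

  open Polynomials R
  open TannyDowling R m
  open CommutativeRing polyRing hiding (zero)
  open NaturalScalars polyRing using (ι)
  open WhitneyTransform polyRing X (const m)
  open StieltjesTable polyRing using (path)
  open import Relation.Binary.Reasoning.Setoid setoid

  private
    module R where
      open CommutativeRing R public
      open NaturalScalars R public using (ι)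
    module W = WhitneyNumbers R m
    open PowerSeries R using (coeffwise)

  const-cong : ∀ {r s} → r R.≈ s → const r ≈ const s
  const-cong r≈s = coeffwiseₚ (coeffwise λ { zero → r≈s ; (suc n) → R.refl })

  const-0 : const R.0# ≈ 0#
  const-0 = coeffwiseₚ (coeffwise λ { zero → R.refl ; (suc n) → R.refl })

  const-+ : ∀ r s → const (r R.+ s) ≈ const r + const s
  const-+ r s = coeffwiseₚ (coeffwise λ { zero → R.refl ; (suc n) → R.sym (R.+-identityʳ R.0#) })

  const-* : ∀ r s → const (r R.* s) ≈ const r * const s
  const-* r s = coeffwiseₚ (coeffwise λ n → R.sym (R.trans (StieltjesTable.constₛ-⊛ R r (coeff (const s)) n)
    (scaled n)))
    where
    scaled : ∀ n → r R.* coeff (const s) n R.≈ coeff (const (r R.* s)) n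
    scaled zero    = R.refl
    scaled (suc n) = R.zeroʳ r

  const-ι : ∀ n → const (R.ι n) ≈ ι n
  const-ι zero    = const-0
  const-ι (suc n) = trans (const-+ R.1# (R.ι n)) (+-congˡ {1#} (const-ι n))

  w : ℕ → ℕ → Poly
  w n k = const (W n k)

  w-suc : ∀ n k → w (suc n) (suc k) ≈ w n k + (1# + ι (suc k) * const m) * w n (suc k)
  w-suc n k = begin
    const (W (suc n) (suc k))
      ≈⟨ const-cong (W.W-suc n k) ⟩
    const (W n k R.+ (R.1# R.+ R.ι (suc k) R.* m) R.* W n (suc k))
      ≈⟨ trans (const-+ _ _) (+-congˡ {w n k} (trans (const-* _ _) (*-congʳ {w n (suc k)} (trans (const-+ _ _)
           (+-congˡ {1#} (trans (const-* _ _) (*-congʳ {const m} (const-ι (suc k))))))))) ⟩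
    w n k + (1# + ι (suc k) * const m) * w n (suc k) ∎

  𝓕≈path : ∀ n → 𝓕 n ≈ path levelWeightₘ downWeightₘ n 0
  𝓕≈path = moments-w w (λ n → const-cong (W.W-zero n)) (λ n k n<k → trans (const-cong (W.W-high n k n<k)) const-0) w-suc

mainTheorem6 : ∀ {c ℓ} (R : CommutativeRing c ℓ) (m : CommutativeRing.Carrier R) →
    let open Polynomials R
        open TannyDowling R m
        open CommutativeRing polyRing
        open Mult semiring renaming (_×_ to _·_)
        open Exp semiring using (_^_)
        open PowerSeries polyRing
        open Determinants polyRing
        b = λ (n : ℕ) → (2 ℕ.* n ℕ.+ 1) · X + n · const m + 1#
        l = λ (n : ℕ) → (n ℕ.^ 2) · (X * (X + const m))
    in
    (jFraction b l ⟶ 𝓕)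
    ×
    (∀ n → hankel 𝓕 n ≈
       (X * (X + const m)) ^ (suc n C 2)
         * product (Semiring.rawSemiring semiring) {suc n} (λ k → ((toℕ k !) · 1#) ^ 2))
mainTheorem6 R m = fraction-and-hankel (Polynomials.polyRing R) (Polynomials.X R) (Polynomials.const R m)
  (TannyDowling.𝓕 R m) (TannyDowlingMoments.𝓕≈path R m)
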